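{- Let $G$ be a connected graph of order $n\ge 7$. Then $\beta_p(G)=n-2$ if and only if $G$ is isomorphic to one of the graphs $H_1,\dots,H_{11},H_{13},H_{14},H_{15},H_{16}$ defined below (i.e. one of $H_1,\dots,H_{17}$ other than $H_{12}$ and $H_{17}$).
   Context: All graphs are finite, simple, undirected and connected. For $v\in V(G)$ and $S\subseteq V(G)$, $d(v,S)=\min\{d(v,w):w\in S\}$. For a partition $\Pi=\{S_1,\dots,S_k\}$ of $V(G)$, $r(u|\Pi)=(d(u,S_1),\dots,d(u,S_k))$; $\Pi$ is resolving if $r(u|\Pi)\ne r(v|\Pi)$ for all distinct $u,v$. $\beta_p(G)$ is the minimum cardinality of a resolving partition. Notation: $K_m$ complete graph, $\overline{K_m}$ edgeless graph on $m$ vertices, $P_m$ path, $C_4$ 4-cycle, $2K_2$ two disjoint edges, $+$ disjoint union, $\vee$ join. The graphs (order $n$): $H_1=K_{n-3}\vee(K_2+K_1)$; $H_2=K_{n-3}\vee\overline{K_3}$; $H_3=K_{n-4}\vee C_4$; $H_4=K_{n-4}\vee P_4$; $H_5=K_{n-4}\vee 2K_2$; $H_6=K_{2,n-2}$; $H_7=\overline{K_{n-2}}\vee K_2$; $H_8=(K_{n-3}+K_1)\vee K_2$; $H_9=(K_{n-3}+K_1)\vee\overline{K_2}$; $H_{10}=(K_{n-3}+K_2)\vee K_1$; $H_{11}$ is obtained from $(K_{n-4}+K_1)\vee P_3$ by deleting the edge joining the vertex of $K_1$ to one end-vertex of $P_3$; $H_{12}=(\overline{K_{n-3}}+K_2)\vee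 K_1$; $H_{13}=(K_{n-3}+\overline{K_2})\vee K_1$; $H_{14}=K_1\vee(K_1+(K_{n-2}-e))$ with $K_{n-2}-e$ the complete graph minus one edge; $H_{15}$: a clique $Q\cong K_{n-3}$, two nonadjacent vertices $b,c$ each adjacent to all of $Q$, and a vertex $a$ adjacent only to $c$; $H_{16}$: a clique $Q\cong K_{n-3}$, a vertex $x$ adjacent to all of $Q$ and to a vertex $w$, and a vertex $u$ adjacent only to $w$; $H_{17}$: a vertex $c$ adjacent to $n-3$ leaves and to a vertex $b$, and a vertex $a$ adjacent only to $b$. -}

module Defs where

open import Data.Nat using (ℕ; zero; suc; _≡ᵇ_; _<ᵇ_; _≤ᵇ_; _⊓_; _≤_)
open import Data.Bool using (Bool; true; false; _∧_; _∨_; not; if_then_else_)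
open import Data.Bool.Properties using (∨-comm)
open import Data.Fin using (Fin; toℕ; _≟_)
open import Data.Fin.Properties using (toℕ-injective)
open import Data.List using (List; foldr)
open import Data.Bool.ListAction using (any)
open import Data.List using () renaming (allFin to allFinL)
open import Data.Vec using (Vec; tabulate)
open import Data.Product using (Σ; ∃; _×_; _,_)
open import Relation.Nullary using (¬_)
open import Relation.Nullary.Decidable using (⌊_⌋)
open import Relation.Binary.PropositionalEquality using (_≡_; refl; cong₂)
open import Function.Bundles using (_↔_; Inverse)

record Graph (n : ℕ) : Set where
  field
    adj    : Fin n → Fin n → Bool
    sym    : ∀ u v → adj u v ≡ adj v u
    irrefl : ∀ u → adj u u ≡ false
open Graph public

ball : ∀ {n} → Graph n → ℕ → Fin n → Fin n → Bool
ball G zero    u v = ⌊ u ≟ v ⌋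
ball G (suc k) u v = ball G k u v ∨ any (λ w → ball G k u w ∧ adj G w v) (allFinL _)

Connected : ∀ {n} → Graph n → Set
Connected G = ∀ u v → ∃ λ k → ball G k u v ≡ true

-- least k < fuel with p k = true (returns fuel if none)
least : ℕ → (ℕ → Bool) → ℕ
least zero    p = zero
least (suc f) p = if p zero then zero else suc (least f (λ k → p (suc k)))

-- graph distance d(u,v) = least k with a walk of length ≤ k from u to v
-- (for connected graphs of order n this is always < n)
dist : ∀ {n} → Graph n → Fin n → Fin n → ℕ
dist {n} G u v = least n (λ k → ball G k u v)

-- d(u,S) = min { d(u,w) : w ∈ S }, S given by its characteristic function
-- (n acts as +∞; only applied to nonempty S)
distSet : ∀ {n} → Graph n → Fin n → (Fin n → Bool) → ℕ
distSet {n} G u S = foldr (λ w m → if S w then dist G u w ⊓ m else m) n (allFinL n)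

-- Partitions with k classes: a surjective class map c : Fin n → Fin k;
-- the i-th class is S_i = { w : c w = i }.

Class : ∀ {n k} → (Fin n → Fin k) → Fin k → Fin n → Bool
Class c i w = ⌊ c w ≟ i ⌋

rep : ∀ {n k} → Graph n → (Fin n → Fin k) → Fin n → Vec ℕ k
rep G c u = tabulate (λ i → distSet G u (Class c i))

record ResolvingPartition {n} (G : Graph n) (k : ℕ) : Set where
  field
    cls       : Fin n → Fin k
    nonempty  : ∀ i → ∃ λ w → cls w ≡ i
    resolving : ∀ u v → ¬ u ≡ v → ¬ rep G cls u ≡ rep G cls v

PartitionDimension : ∀ {n} → Graph n → ℕ → Set
PartitionDimension G m = ResolvingPartition G m × (∀ k → ResolvingPartition G k → m ≤ k)

_≅_ : ∀ {n} → Graph n → Graph n → Set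
_≅_ {n} G H = Σ (Fin n ↔ Fin n) λ φ → ∀ u v → adj G u v ≡ adj H (Inverse.to φ u) (Inverse.to φ v)

private
  ≡ᵇ-sym : ∀ a b → (a ≡ᵇ b) ≡ (b ≡ᵇ a)
  ≡ᵇ-sym zero zero = refl
  ≡ᵇ-sym zero (suc b) = refl
  ≡ᵇ-sym (suc a) zero = refl
  ≡ᵇ-sym (suc a) (suc b) = ≡ᵇ-sym a b

  ≡ᵇ-refl : ∀ a → (a ≡ᵇ a) ≡ true
  ≡ᵇ-refl zero = refl
  ≡ᵇ-refl (suc a) = ≡ᵇ-refl a

mkGraph : (n : ℕ) → (ℕ → ℕ → Bool) → Graph n
mkGraph n R = record
  { adj    = λ u v → not (toℕ u ≡ᵇ toℕ v) ∧ (R (toℕ u) (toℕ v) ∨ R (toℕ v) (toℕ u))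
  ; sym    = λ u v → cong₂ (λ x y → not x ∧ y) (≡ᵇ-sym (toℕ u) (toℕ v)) (∨-comm (R (toℕ u) (toℕ v)) _)
  ; irrefl = λ u → helper (toℕ u) }
  where
    helper : ∀ a → not (a ≡ᵇ a) ∧ (R a a ∨ R a a) ≡ false
    helper a rewrite ≡ᵇ-refl a = refl

_==_ : ℕ → ℕ → Bool
a == b = a ≡ᵇ b

_≥_ : ℕ → ℕ → Bool
a ≥ b = b ≤ᵇ a

infix 7 _==_ _≥_

-- H1 = K_{n-3} ∨ (K_2 + K_1): K_2 = {0,1}, K_1 = {2}, K_{n-3} = {3,…}
H1 : (n : ℕ) → Graph n
H1 n = mkGraph n (λ a b → (a == 0 ∧ b == 1) ∨ b ≥ 3)

-- H2 = K_{n-3} ∨ \bar{K_3}: \bar{K_3} = {0,1,2}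
H2 : (n : ℕ) → Graph n
H2 n = mkGraph n (λ a b → b ≥ 3)

-- H3 = K_{n-4} ∨ C_4: C_4 = 0-1-2-3-0
H3 : (n : ℕ) → Graph n
H3 n = mkGraph n (λ a b → (a == 0 ∧ b == 1) ∨ (a == 1 ∧ b == 2) ∨ (a == 2 ∧ b == 3) ∨ (a == 3 ∧ b == 0) ∨ b ≥ 4)

-- H4 = K_{n-4} ∨ P_4: P_4 = 0-1-2-3
H4 : (n : ℕ) → Graph n
H4 n = mkGraph n (λ a b → (a == 0 ∧ b == 1) ∨ (a == 1 ∧ b == 2) ∨ (a == 2 ∧ b == 3) ∨ b ≥ 4)

-- H5 = K_{n-4} ∨ 2K_2: edges 01, 23
H5 : (n : ℕ) → Graph n
H5 n = mkGraph n (λ a b → (a == 0 ∧ b == 1) ∨ (a == 2 ∧ b == 3) ∨ b ≥ 4)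

-- H6 = K_{2,n-2}: parts {0,1} and {2,…}
H6 : (n : ℕ) → Graph n
H6 n = mkGraph n (λ a b → (a <ᵇ 2) ∧ b ≥ 2)

-- H7 = \bar{K_{n-2}} ∨ K_2: K_2 = {0,1}
H7 : (n : ℕ) → Graph n
H7 n = mkGraph n (λ a b → a <ᵇ 2)

-- H8 = (K_{n-3} + K_1) ∨ K_2: K_2 = {0,1}, K_1 = {2}, K_{n-3} = {3,…}
H8 : (n : ℕ) → Graph n
H8 n = mkGraph n (λ a b → (a <ᵇ 2) ∨ (a ≥ 3 ∧ b ≥ 3))

-- H9 = (K_{n-3} + K_1) ∨ \bar{K_2}: \bar{K_2} = {0,1}, K_1 = {2}, K_{n-3} = {3,…}
H9 : (n : ℕ) → Graph n
H9 n = mkGraph n (λ a b → ((a <ᵇ 2) ∧ b ≥ 2) ∨ (a ≥ 3 ∧ b ≥ 3))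

-- H10 = (K_{n-3} + K_2) ∨ K_1: K_1 = {0}, K_2 = {1,2}, K_{n-3} = {3,…}
H10 : (n : ℕ) → Graph n
H10 n = mkGraph n (λ a b → a == 0 ∨ (a == 1 ∧ b == 2) ∨ (a ≥ 3 ∧ b ≥ 3))

-- H11: from (K_{n-4} + K_1) ∨ P_3 (P_3 = 0-1-2, K_1 = {3}, K_{n-4} = {4,…})
-- delete the edge {3,0} joining K_1 to the end-vertex 0 of P_3
H11 : (n : ℕ) → Graph n
H11 n = mkGraph n (λ a b → (a == 0 ∧ b == 1) ∨ (a == 1 ∧ b == 2)
                          ∨ ((2 ≥ a) ∧ b ≥ 3 ∧ not (a == 0 ∧ b == 3))
                          ∨ (a ≥ 4 ∧ b ≥ 4))

-- H13 = (K_{n-3} + \bar{K_2}) ∨ K_1: K_1 = {0}, \bar{K_2} = {1,2}, K_{n-3} = {3,…}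
H13 : (n : ℕ) → Graph n
H13 n = mkGraph n (λ a b → a == 0 ∨ (a ≥ 3 ∧ b ≥ 3))

-- H14 = K_1 ∨ (K_1 + (K_{n-2} - e)): centre 0, K_1 = {1},
-- K_{n-2} - e on {2,…} with the missing edge e = {2,3}
H14 : (n : ℕ) → Graph n
H14 n = mkGraph n (λ a b → a == 0 ∨ (a ≥ 2 ∧ b ≥ 2 ∧ not ((a == 2 ∧ b == 3) ∨ (a == 3 ∧ b == 2))))

-- H15: clique Q = {3,…} (K_{n-3}), b = 1, c = 2 adjacent to all of Q
-- (b,c nonadjacent), a = 0 adjacent only to c
H15 : (n : ℕ) → Graph n
H15 n = mkGraph n (λ a b → (a == 0 ∧ b == 2) ∨ (a ≥ 1 ∧ b ≥ 3))

-- H16: clique Q = {3,…} (K_{n-3}), x = 2 adjacent to all of Q and to w = 1,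
-- u = 0 adjacent only to w
H16 : (n : ℕ) → Graph n
H16 n = mkGraph n (λ a b → (a == 0 ∧ b == 1) ∨ (a == 1 ∧ b == 2) ∨ (a ≥ 2 ∧ b ≥ 3))

{-# OPTIONS --safe #-}
module Submission where

-- A partition of the vertices is resolving as soon as any two vertices of a class are separated by a class
-- adjacent to exactly one of them. Such a certificate with n - 3 classes on an induced subgraph extends to the
-- whole graph by singletons, so the graphs without one form a hereditary class. Up to order 7 this class is
-- found by one-vertex extensions; for every n ≥ 7 it consists of 27 graphs: the 15 graphs of the theorem, four
-- graphs with partition dimension at least n - 1 and eight disconnected graphs. Each is a homogeneous set (a
-- clique or an independent set of twins) together with at most four further vertices. If G has order n + 1,
-- then G minus a vertex is one of the 27 graphs, so G contains twins a and b; hence G arises from G - a, which is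
-- also one of the 27 graphs, by duplicating b. From n = 9 on there are three twins and a fourth vertex alike,
-- and then the duplicate either joins the homogeneous set or creates a certificate.
--
-- For the lower bounds, a resolving partition puts the vertices of the homogeneous set into distinct classes, so
-- with n - 3 classes at least three of the four remaining vertices share a class with another vertex. In each of
-- the finitely many patterns two vertices of one class have the same distances to all classes.

open import Data.Bool using (Bool; T; _∧_; _∨_; false; if_then_else_; not; true)
open import Data.Bool.ListAction using (any)
open import Data.Bool.Properties as Bool using (not-¬; ¬-not; ∨-zeroʳ)
open import Data.Empty using (⊥; ⊥-elim)
open import Data.Fin as Fin using
  (Fin; _↑ʳ_; _↑ˡ_; _≟_; fromℕ; fromℕ<; inject₁; inject≤; punchIn; punchOut; splitAt; suc; toℕ; zero)
open import Data.Fin.Patterns using (0F; 4F)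
open import Data.Fin.Properties using
  (any?; fromℕ≢inject₁; injective⇒≤; inject₁-injective; inject≤-injective; punchIn-injective;
   punchIn-punchOut; punchInᵢ≢i; punchOut-injective; splitAt-↑ʳ; splitAt-↑ˡ; splitAt⁻¹-↑ʳ; splitAt⁻¹-↑ˡ;
   suc-injective; toℕ-fromℕ; toℕ-fromℕ<; toℕ-injective; toℕ-inject₁; toℕ-inject≤; toℕ-↑ʳ; toℕ-↑ˡ; toℕ<n;
   ↑ʳ-injective; ↑ˡ-injective)
open import Data.List as List using (List; []; _∷_; allFin; deduplicate; foldr; length; lookup; map)
open import Data.List.Membership.Propositional using (_∈_)
open import Data.List.Membership.Propositional.Properties using
  (∈-allFin; ∈-deduplicate⁺; ∈-deduplicate⁻; ∈-lookup; ∈-map⁺; ∈-map⁻)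
open import Data.List.Relation.Unary.All as All using ([]; _∷_)
open import Data.List.Relation.Unary.AllPairs using ([]; _∷_)
open import Data.List.Relation.Unary.Any using (here; index; there)
open import Data.List.Relation.Unary.Any.Properties using (lookup-index)
import Data.List.Relation.Unary.Unique.DecPropositional.Properties as UniqueDec
open import Data.List.Relation.Unary.Unique.Propositional using (Unique)
open import Data.Maybe as Maybe using (Maybe; _<∣>_; is-just; just; nothing)
open import Data.Nat as ℕ using
  (_%_; _+_; _/_; _<_; _<ᵇ_; _^_; _∸_; _≡ᵇ_; _≤_; _⊓_; suc; s≤s; s≤s⁻¹; zero; z≤n; ℕ)
open import Data.Nat.DivMod using (_mod_)
open import Data.Nat.Properties using
  (+-cancelˡ-≤; +-comm; +-identityʳ; +-monoˡ-≤; +-suc; <⇒≢; <⇒≤; _<?_; _≤?_; m≤m+n; m≤n⇒m<n∨m≡n; m≤n⇒m⊓n≡m;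
   m≥n⇒m⊓n≡n; m⊓n≤m; m⊓n≤n; n≤1+n; n≮n; ≡ᵇ⇒≡; ≤-antisym; ≤-refl; ≤-reflexive; ≤-trans; ≮⇒≥; ≰⇒>; ⊓-glb)
open import Data.Product using (_,_; _×_; proj₁; proj₂; ∃; ∃₂)
open import Data.Sum as Sum using ([_,_]′; _⊎_; inj₁; inj₂)
open import Data.Vec as Vec using (Vec; []; _++_; _∷_)
open import Data.Vec.Properties using (lookup∘tabulate; tabulate-cong)
open import Defs renaming (sym to adj-sym; irrefl to adj-irrefl)
open import Function using (_∘_; case_of_)
open import Function.Bundles using (Inverse; _⇔_; mk↔ₛ′; mk⇔)
open import Function.Definitions using (Injective)
open import Relation.Binary.PropositionalEquality using
  (_≡_; _≢_; cong; cong₂; refl; subst; subst₂; sym; trans)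
open import Relation.Nullary using (Dec; contradiction; does; no; yes; ¬_)
open import Relation.Nullary.Decidable using
  (_×-dec_; _→-dec_; _⊎-dec_; dec-false; dec-true; dec⇒maybe; map′; ¬?; ⌊_⌋)

private
  variable
    c k l m n r : ℕ

-- Distances

any⁻ : ∀ {A : Set} (p : A → Bool) xs → any p xs ≡ true → ∃ λ w → p w ≡ true
any⁻ p (x ∷ xs) eq with p x in px
... | true  = x , px
... | false = any⁻ p xs eq

any⁺ : ∀ {A : Set} (p : A → Bool) {xs w} → w ∈ xs → p w ≡ true → any p xs ≡ true
any⁺ p (here refl) pw rewrite pw = refl
any⁺ p {x ∷ xs} (there w∈xs) pw rewrite any⁺ p w∈xs pw = ∨-zeroʳ (p x)

⌊⌋⁺ : ∀ {P : Set} (P? : Dec P) → P → ⌊ P? ⌋ ≡ true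
⌊⌋⁺ (yes _) p = refl
⌊⌋⁺ (no ¬p) p = contradiction p ¬p

⌊⌋⁻ : ∀ {P : Set} (P? : Dec P) → ⌊ P? ⌋ ≡ true → P
⌊⌋⁻ (yes p) _ = p

∨⁻ : ∀ a {b} → a ∨ b ≡ true → a ≡ true ⊎ b ≡ true
∨⁻ true  _  = inj₁ refl
∨⁻ false eq = inj₂ eq

∧⁻ : ∀ a {b} → a ∧ b ≡ true → a ≡ true × b ≡ true
∧⁻ true eq = refl , eq

ball-step : ∀ (G : Graph n) k u v {w} → ball G k u w ≡ true → adj G w v ≡ true → ball G (suc k) u v ≡ true
ball-step G k u v {w} near wv
  rewrite any⁺ (λ w → ball G k u w ∧ adj G w v) (∈-allFin w) (cong₂ _∧_ near wv) = ∨-zeroʳ _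

ball-mono : ∀ (G : Graph n) k u v → ball G k u v ≡ true → ball G (suc k) u v ≡ true
ball-mono G k u v eq rewrite eq = refl

ball-suc⁻ : ∀ (G : Graph n) k u v → ball G (suc k) u v ≡ true →
            ball G k u v ≡ true ⊎ ∃ λ w → ball G k u w ≡ true × adj G w v ≡ true
ball-suc⁻ G k u v eq with ∨⁻ (ball G k u v) eq
... | inj₁ near = inj₁ near
... | inj₂ far  with any⁻ _ (allFin _) far
...   | w , both = inj₂ (w , ∧⁻ (ball G k u w) both)

least-≤ : ∀ f p k → p k ≡ true → least f p ≤ k
least-≤ zero    p k       pk = z≤n
least-≤ (suc f) p k       pk with p 0 in p0
... | true  = z≤n
least-≤ (suc f) p zero    pk | false = case trans (sym pk) p0 of λ ()
least-≤ (suc f) p (suc k) pk | false = s≤s (least-≤ f (p ∘ suc) k pk)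

least-≥ : ∀ f p m → m ≤ f → (∀ k → k < m → p k ≡ false) → m ≤ least f p
least-≥ f       p zero    _         _     = z≤n
least-≥ (suc f) p (suc m) (s≤s m≤f) below rewrite below 0 (s≤s z≤n) =
  s≤s (least-≥ f (p ∘ suc) m m≤f (λ k k<m → below (suc k) (s≤s k<m)))

module _ (G : Graph n) where

  dist-adjacent : ∀ {u w} → adj G u w ≡ true → dist G u w ≤ 1
  dist-adjacent {u} {w} uw =
    least-≤ n _ 1 (ball-step G 0 u w (⌊⌋⁺ (u ≟ u) refl) uw)

  -- `least` never exceeds its fuel `n`, so `2 ≤ n` leaves room for the value 2.
  dist-nonadjacent : ∀ {u w} → 2 ≤ n → u ≢ w → adj G u w ≡ false → 2 ≤ dist G u w
  dist-nonadjacent {u} {w} 2≤n u≢w uw = least-≥ n _ 2 2≤n λ where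
      0 _               → ¬-not (u≢w ∘ ⌊⌋⁻ (u ≟ w))
      1 _               → ¬-not λ near → case ball-suc⁻ G 0 u w near of λ where
        (inj₁ eq)           → u≢w (⌊⌋⁻ (u ≟ w) eq)
        (inj₂ (x , eq , xw)) → not-¬ uw (subst (λ y → adj G y w ≡ true) (sym (⌊⌋⁻ (u ≟ x) eq)) xw)
      (suc (suc _)) (s≤s (s≤s ()))

  private
    nearest : (Fin n → ℕ) → (Fin n → Bool) → List (Fin n) → ℕ
    nearest d S = foldr (λ w m → if S w then d w ⊓ m else m) n

    nearest-≤ : ∀ d S {xs w} → w ∈ xs → S w ≡ true → nearest d S xs ≤ d w
    nearest-≤ d S (here refl) Sw rewrite Sw = m⊓n≤m _ _
    nearest-≤ d S {x ∷ xs} (there w∈xs) Sw with S x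
    ... | true  = ≤-trans (m⊓n≤n (d x) _) (nearest-≤ d S w∈xs Sw)
    ... | false = nearest-≤ d S w∈xs Sw

    nearest-≥ : ∀ d S m → m ≤ n → (∀ w → S w ≡ true → m ≤ d w) → ∀ xs → m ≤ nearest d S xs
    nearest-≥ d S m m≤n below []       = m≤n
    nearest-≥ d S m m≤n below (x ∷ xs) with S x in Sx
    ... | true  = ⊓-glb (below x Sx) (nearest-≥ d S m m≤n below xs)
    ... | false = nearest-≥ d S m m≤n below xs

  distSet-≤ : ∀ {u} S {w} → S w ≡ true → distSet G u S ≤ dist G u w
  distSet-≤ {u} S {w} = nearest-≤ (dist G u) S (∈-allFin w)

  distSet-≥ : ∀ {u} S {m} → m ≤ n → (∀ w → S w ≡ true → m ≤ dist G u w) → m ≤ distSet G u S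
  distSet-≥ {u} S {m} m≤n below = nearest-≥ (dist G u) S m m≤n below (allFin n)

  rep-distSet : ∀ (c : Fin n → Fin k) {u v} → rep G c u ≡ rep G c v →
                ∀ i → distSet G u (Class c i) ≡ distSet G v (Class c i)
  rep-distSet c {u} {v} eq i =
    trans (sym (lookup∘tabulate _ i)) (trans (cong (λ t → Vec.lookup t i) eq) (lookup∘tabulate _ i))

least-≤-fuel : ∀ f p → least f p ≤ f
least-≤-fuel zero    p = z≤n
least-≤-fuel (suc f) p with p 0
... | true  = z≤n
... | false = s≤s (least-≤-fuel f (p ∘ suc))

module _ (G : Graph n) (δ : Fin n → Fin n → ℕ)
         (δ-≤     : ∀ u v → δ u v ≤ n)
         (δ-self  : ∀ u → δ u u ≡ 0)
         (δ-zero  : ∀ u v → δ u v ≡ 0 → u ≡ v)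
         (δ-step  : ∀ u v w → adj G w v ≡ true → δ u v ≤ suc (δ u w))
         (δ-pred  : ∀ u v k → δ u v ≡ suc k → ∃ λ w → adj G w v ≡ true × δ u w ≤ k) where

  private
    ball⇒δ : ∀ k u v → ball G k u v ≡ true → δ u v ≤ k
    ball⇒δ zero    u v near = ≤-reflexive (trans (cong (δ u) (sym (⌊⌋⁻ (u ≟ v) near))) (δ-self u))
    ball⇒δ (suc k) u v near with ball-suc⁻ G k u v near
    ... | inj₁ near′           = ≤-trans (ball⇒δ k u v near′) (n≤1+n k)
    ... | inj₂ (w , near′ , wv) = ≤-trans (δ-step u v w wv) (s≤s (ball⇒δ k u w near′))

    δ⇒ball : ∀ k u v → δ u v ≤ k → ball G k u v ≡ true
    δ⇒ball zero    u v le = ⌊⌋⁺ (u ≟ v) (δ-zero u v (≤-antisym le z≤n))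
    δ⇒ball (suc k) u v le with m≤n⇒m<n∨m≡n le
    ... | inj₁ lt = ball-mono G k u v (δ⇒ball k u v (s≤s⁻¹ lt))
    ... | inj₂ eq with δ-pred u v k eq
    ...   | w , wv , near = ball-step G k u v (δ⇒ball k u w near) wv

  -- The balls around `u` are the sublevel sets of `δ u`: a walk raises `δ u` by at most one per
  -- edge, and `δ-pred` leads back from `v` towards `u`. By `δ-≤` the fuel `n` of `dist` does not
  -- cut the search short.
  dist-unique : ∀ u v → dist G u v ≡ δ u v
  dist-unique u v = ≤-antisym
    (least-≤ n _ (δ u v) (δ⇒ball (δ u v) u v ≤-refl))
    (least-≥ n _ (δ u v) (δ-≤ u v) λ k k<δ → Bool.¬-not λ near → n≮n k (≤-trans k<δ (ball⇒δ k u v near)))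

distSet-mono : (G : Graph n) (S : Fin n → Bool) {u v : Fin n} →
               (∀ w → S w ≡ true → ∃ λ w′ → S w′ ≡ true × dist G v w′ ≤ dist G u w) →
               (∃ λ w → S w ≡ true) → distSet G v S ≤ distSet G u S
distSet-mono {n} G S {u} {v} closer (w , w∈S) = distSet-≥ G S
  -- `distSet-≥` accepts only bounds up to its default value `n`; an element of `S` shows that this
  -- bound is one.
  (≤-trans (distSet-≤ G S w∈S) (least-≤-fuel n _))
  λ x x∈S → let y , y∈S , le = closer x x∈S in ≤-trans (distSet-≤ G S y∈S) le

-- Both vertices are at distance zero from their own class. For any other class the two hypotheses
-- give the two inequalities between the distances; `w′` may be any vertex of the class of `w`,
-- since only the minimum over the class enters.
indistinguishable : (G : Graph n) (P : ResolvingPartition G k) → let open ResolvingPartition P in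
  ∀ {u v} → u ≢ v → cls u ≡ cls v →
  (∀ w → cls w ≢ cls u → ∃ λ w′ → cls w′ ≡ cls w × dist G v w′ ≤ dist G u w) →
  (∀ w → cls w ≢ cls u → ∃ λ w′ → cls w′ ≡ cls w × dist G u w′ ≤ dist G v w) → ⊥
indistinguishable {n} G P {u} {v} u≢v same closer closer′ = resolving u v u≢v (tabulate-cong equal)
  where
  open ResolvingPartition P

  zeroAt : ∀ x → distSet G x (Class cls (cls x)) ≡ 0
  zeroAt x = ≤-antisym (≤-trans (distSet-≤ G _ (⌊⌋⁺ (cls x ≟ cls x) refl)) (least-≤ n _ 0 (⌊⌋⁺ (x ≟ x) refl))) z≤n

  toClass : ∀ {x y} i → cls u ≢ i →
            (∀ w → cls w ≢ cls u → ∃ λ w′ → cls w′ ≡ cls w × dist G y w′ ≤ dist G x w) →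
            distSet G y (Class cls i) ≤ distSet G x (Class cls i)
  toClass i u∉i near = distSet-mono G (Class cls i)
    (λ w w∈i → let w≡i = ⌊⌋⁻ (cls w ≟ i) w∈i ; w′ , w′∼w , le = near w (λ w∼u → u∉i (trans (sym w∼u) w≡i)) in
       w′ , ⌊⌋⁺ (cls w′ ≟ i) (trans w′∼w w≡i) , le)
    (let w , w≡i = nonempty i in w , ⌊⌋⁺ (cls w ≟ i) w≡i)

  equal : ∀ i → distSet G u (Class cls i) ≡ distSet G v (Class cls i)
  equal i with cls u ≟ i
  ... | yes refl = trans (zeroAt u) (sym (trans (cong (λ j → distSet G v (Class cls j)) same) (zeroAt v)))
  ... | no  u∉i  = ≤-antisym (toClass i u∉i closer′) (toClass i u∉i closer)

-- Certificates for resolving partitions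

module Separation {n} (G : Graph n) (root : Fin n → Fin n) where

  Misses : Fin n → Fin n → Set
  Misses v w = ∀ x → root x ≡ root w → adj G v x ≡ false

  -- The class of w has distance 1 from one of u, v and distance at least 2 from the other.
  Separates : Fin n → Fin n → Fin n → Set
  Separates u v w = root w ≢ root u ×
    ((adj G u w ≡ true × Misses v w) ⊎ (adj G v w ≡ true × Misses u w))

-- The classes are the fibres of root; the r absorbed vertices are not roots, so there are at most n ∸ r classes.
record Certificate {n} (G : Graph n) (r : ℕ) : Set where
  field
    root               : Fin n → Fin n
    absorbed           : Fin r → Fin n
    absorbed-injective : Injective _≡_ _≡_ absorbed
    root≢absorbed      : ∀ u i → root u ≢ absorbed i

  open Separation G root public

  field
    separated : ∀ u v → u ≢ v → root u ≡ root v → ∃ (Separates u v)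

lookup-injective : ∀ {A : Set} {xs : List A} → Unique xs → ∀ i j → lookup xs i ≡ lookup xs j → i ≡ j
lookup-injective (_ ∷ _)   zero    zero    _  = refl
lookup-injective (≢s ∷ _)  zero    (suc j) eq = contradiction eq (All.lookup ≢s (∈-lookup j))
lookup-injective (≢s ∷ _)  (suc i) zero    eq = contradiction (sym eq) (All.lookup ≢s (∈-lookup i))
lookup-injective (_ ∷ u)   (suc i) (suc j) eq = cong suc (lookup-injective u i j eq)

-- Classes are numbered by the duplicate-free list of roots. Roots and absorbed vertices are all
-- distinct, so together they inject into the vertices, whence `k + r ≤ n`. Vertices of different
-- classes differ at the class of the first (distance zero against at least one); vertices of one
-- class differ at a separating class (one against at least two).
certificate⇒resolvingPartition : ∀ {n r} {G : Graph n} → 2 ≤ n → Certificate G r →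
                                 ∃ λ k → k + r ≤ n × ResolvingPartition G k
certificate⇒resolvingPartition {n} {r} {G} 2≤n C = size , injective⇒≤ join-injective , partition
  where
  open Certificate C

  roots : List (Fin n)
  roots = deduplicate _≟_ (map root (allFin n))

  roots-unique : Unique roots
  roots-unique = UniqueDec.deduplicate-! _≟_ _

  size : ℕ
  size = length roots

  root∈ : ∀ u → root u ∈ roots
  root∈ u = ∈-deduplicate⁺ _≟_ (∈-map⁺ root (∈-allFin u))

  isRoot : ∀ i → ∃ λ u → lookup roots i ≡ root u
  isRoot i with ∈-map⁻ root (∈-deduplicate⁻ _≟_ (map root (allFin n)) (∈-lookup i))
  ... | u , _ , eq = u , eq

  cls : Fin n → Fin size
  cls u = index (root∈ u)

  lookup-cls : ∀ u → root u ≡ lookup roots (cls u)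
  lookup-cls u = lookup-index (root∈ u)

  cls⇒root : ∀ {u v} → cls u ≡ cls v → root u ≡ root v
  cls⇒root {u} {v} eq = trans (lookup-cls u) (trans (cong (lookup roots) eq) (sym (lookup-cls v)))

  join : Fin (size + r) → Fin n
  join i = [ lookup roots , absorbed ]′ (splitAt size i)

  join-injective : Injective _≡_ _≡_ join
  join-injective {i} {j} eq with splitAt size i in si | splitAt size j in sj
  ... | inj₁ a | inj₁ b = trans (sym (splitAt⁻¹-↑ˡ si))
          (trans (cong (_↑ˡ r) (lookup-injective roots-unique a b eq)) (splitAt⁻¹-↑ˡ sj))
  ... | inj₁ a | inj₂ b = contradiction (trans (sym (proj₂ (isRoot a))) eq) (root≢absorbed _ b)
  ... | inj₂ a | inj₁ b = contradiction (trans (sym (proj₂ (isRoot b))) (sym eq)) (root≢absorbed _ a)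
  ... | inj₂ a | inj₂ b = trans (sym (splitAt⁻¹-↑ʳ si))
          (trans (cong (size ↑ʳ_) (absorbed-injective eq)) (splitAt⁻¹-↑ʳ sj))

  distinguishes : ∀ {u v} w → root w ≢ root v → adj G u w ≡ true → Misses v w →
                  ∃ λ i → distSet G u (Class cls i) ≢ distSet G v (Class cls i)
  distinguishes {u} {v} w w≢v uw misses = cls w , λ eq →
    n≮n 1 (≤-trans far (≤-trans (≤-reflexive (sym eq)) near))
    where
    S = Class cls (cls w)

    near : distSet G u S ≤ 1
    near = ≤-trans (distSet-≤ G S (⌊⌋⁺ (cls w ≟ cls w) refl)) (dist-adjacent G uw)

    far : 2 ≤ distSet G v S
    far = distSet-≥ G S 2≤n λ x x∈S →
      let x∼w = cls⇒root (⌊⌋⁻ (cls x ≟ cls w) x∈S) in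
      dist-nonadjacent G 2≤n (λ { refl → w≢v (sym x∼w) }) (misses x x∼w)

  resolving : ∀ u v → ¬ u ≡ v → ¬ rep G cls u ≡ rep G cls v
  resolving u v u≢v reps with root u ≟ root v
  ... | yes same with separated u v u≢v same
  ...   | w , w≢ , inj₁ (uw , misses) =
            let i , neq = distinguishes w (λ w≡ → w≢ (trans w≡ (sym same))) uw misses in
            neq (rep-distSet G cls reps i)
  ...   | w , w≢ , inj₂ (vw , misses) =
            let i , neq = distinguishes w w≢ vw misses in
            neq (sym (rep-distSet G cls reps i))
  resolving u v u≢v reps | no differ = n≮n 0 (≤-trans (outside v differ) (≤-reflexive (sym at)))
    where
    at : 0 ≡ distSet G v (Class cls (cls u))
    at = ≤-antisym z≤n (≤-trans (≤-reflexive (sym (rep-distSet G cls reps (cls u))))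
           (≤-trans (distSet-≤ G _ (⌊⌋⁺ (cls u ≟ cls u) refl))
             (least-≤ n _ 0 (⌊⌋⁺ (u ≟ u) refl))))

    outside : ∀ v → root u ≢ root v → 1 ≤ distSet G v (Class cls (cls u))
    outside v differ = distSet-≥ G _ (≤-trans (s≤s z≤n) 2≤n) λ x x∈S →
      least-≥ n _ 1 (≤-trans (s≤s z≤n) 2≤n) λ where
        0 _ → ¬-not λ eq → differ (sym (trans (cong root (⌊⌋⁻ (v ≟ x) eq)) (cls⇒root (⌊⌋⁻ (cls x ≟ cls u) x∈S))))
        (suc _) (s≤s ())

  partition : ResolvingPartition G size
  partition = record
    { cls       = cls
    ; nonempty  = λ i → let u , eq = isRoot i in
                    u , lookup-injective roots-unique _ _ (trans (sym (lookup-cls u)) (sym eq))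
    ; resolving = resolving
    }

-- Induced subgraphs

infix 4 _↪_

record _↪_ (H : Graph m) (G : Graph n) : Set where
  field
    to        : Fin m → Fin n
    injective : Injective _≡_ _≡_ to
    preserves : ∀ i j → adj H i j ≡ adj G (to i) (to j)

↪-trans : {F : Graph l} {H : Graph m} {G : Graph n} → F ↪ H → H ↪ G → F ↪ G
↪-trans f g = record
  { to        = g.to ∘ f.to
  ; injective = f.injective ∘ g.injective
  ; preserves = λ i j → trans (f.preserves i j) (g.preserves _ _)
  }
  where module f = _↪_ f; module g = _↪_ g

-- Certificates speak of adjacency and not of distance, because an induced subgraph keeps adjacency
-- while its distances may shrink in the larger graph. The class of an image consists of images
-- only, so a missed class stays missed.
certificate-↪ : ∀ {r} {H : Graph m} {G : Graph n} → H ↪ G → Certificate H r → Certificate G r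
certificate-↪ {m} {n} {r} {H} {G} e C = record
  { root               = root′
  ; absorbed           = to ∘ absorbed
  ; absorbed-injective = absorbed-injective ∘ injective
  ; root≢absorbed      = root′≢absorbed
  ; separated          = separated′
  }
  where
  open _↪_ e
  open Certificate C

  Preimage : Fin n → Set
  Preimage x = ∃ λ p → to p ≡ x

  extend : ∀ x → Dec (Preimage x) → Fin n
  extend x (yes (p , _)) = to (root p)
  extend x (no _)        = x

  preimage? : ∀ x → Dec (Preimage x)
  preimage? x = any? (λ p → to p ≟ x)

  root′ : Fin n → Fin n
  root′ x = extend x (preimage? x)

  root′-to : ∀ p → root′ (to p) ≡ to (root p)
  root′-to p with preimage? (to p)
  ... | yes (q , eq) = cong (to ∘ root) (injective eq)
  ... | no ¬pre      = contradiction (p , refl) ¬pre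

  root′⁻ : ∀ x z → root′ x ≡ to z → ∃ λ p → to p ≡ x × root p ≡ z
  root′⁻ x z eq with preimage? x
  ... | yes (p , p↦x) = p , p↦x , injective eq
  ... | no ¬pre       = contradiction (z , sym eq) ¬pre

  root′≢absorbed : ∀ x i → root′ x ≢ to (absorbed i)
  root′≢absorbed x i eq with root′⁻ x (absorbed i) eq
  ... | p , _ , eq′ = root≢absorbed p i eq′

  misses′ : ∀ {p w} → Misses p w → Separation.Misses G root′ (to p) (to w)
  misses′ {p} {w} misses x x∼w with root′⁻ x (root w) (trans x∼w (root′-to w))
  ... | q , refl , q∼w = trans (sym (preserves p q)) (misses q q∼w)

  -- A vertex outside the image forms a class by itself.
  coincide : ∀ x y → x ≢ y → root′ x ≡ root′ y →
             ∃ λ p → ∃ λ q → to p ≡ x × to q ≡ y × root p ≡ root q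
  coincide x y x≢y eq with preimage? x in px | preimage? y in py
  ... | yes (p , p↦x) | yes (q , q↦y) = p , q , p↦x , q↦y , injective eq
  ... | yes (p , p↦x) | no ¬pre       = contradiction (root p , eq) ¬pre
  ... | no ¬pre       | yes (q , _)   = contradiction (root q , sym eq) ¬pre
  ... | no _          | no _          = contradiction eq x≢y

  separated′ : ∀ x y → x ≢ y → root′ x ≡ root′ y → ∃ (Separation.Separates G root′ x y)
  separated′ x y x≢y eq with coincide x y x≢y eq
  ... | p , q , refl , refl , same with separated p q (x≢y ∘ cong to) same
  ...   | w , w≢p , sep = to w
          , (λ eq → w≢p (injective (trans (sym (root′-to w)) (trans eq (root′-to p)))))
          , Sum.map (λ (pw , m) → trans (sym (preserves p w)) pw , misses′ m)
                    (λ (qw , m) → trans (sym (preserves q w)) qw , misses′ m) sep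

opaque
  injective⇒surjective : (f : Fin n → Fin n) → Injective _≡_ _≡_ f → ∀ y → ∃ λ x → f x ≡ y
  injective⇒surjective {suc n} f inj y with any? (λ x → f x ≟ y)
  ... | yes found = found
  ... | no missed = contradiction
          (injective⇒≤ {f = λ x → punchOut (λ eq → missed (x , sym eq))}
            (λ {i} {j} eq → inj (punchOut-injective (λ e → missed (i , sym e)) (λ e → missed (j , sym e)) eq)))
          (n≮n n)

module Inverted {H G : Graph n} (e : H ↪ G) where
  open _↪_ e

  from : Fin n → Fin n
  from y = proj₁ (injective⇒surjective to injective y)

  to-from : ∀ y → to (from y) ≡ y
  to-from y = proj₂ (injective⇒surjective to injective y)

  from-to : ∀ x → from (to x) ≡ x
  from-to x = injective (to-from (to x))

  from-preserves : ∀ u v → adj G u v ≡ adj H (from u) (from v)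
  from-preserves u v =
    trans (sym (cong₂ (adj G) (to-from u) (to-from v))) (sym (preserves (from u) (from v)))

↪-sym : {H G : Graph n} → H ↪ G → G ↪ H
↪-sym e = record
  { to        = from
  ; injective = λ {x} {y} eq → trans (sym (to-from x)) (trans (cong (_↪_.to e) eq) (to-from y))
  ; preserves = from-preserves
  }
  where open Inverted e

↪⇒≅ : {H G : Graph n} → H ↪ G → G ≅ H
↪⇒≅ e = mk↔ₛ′ from (_↪_.to e) from-to to-from , from-preserves
  where open Inverted e

≅⇒↪ : {H G : Graph n} → G ≅ H → G ↪ H
≅⇒↪ (φ , preserves) = record
  { to        = Inverse.to φ
  ; injective = λ {x} {y} eq → trans (sym (Inverse.strictlyInverseʳ φ x))
                                 (trans (cong (Inverse.from φ) eq) (Inverse.strictlyInverseʳ φ y))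
  ; preserves = preserves
  }

delete : Graph (suc n) → Fin (suc n) → Graph n
delete G a = record
  { adj    = λ u v → adj G (punchIn a u) (punchIn a v)
  ; sym    = λ u v → adj-sym G _ _
  ; irrefl = λ u → adj-irrefl G _
  }

delete-↪ : (G : Graph (suc n)) (a : Fin (suc n)) → delete G a ↪ G
delete-↪ G a = record
  { to        = punchIn a
  ; injective = punchIn-injective a _ _
  ; preserves = λ _ _ → refl
  }

extension : (Fin n → Bool) → Graph n → Graph (suc n)
extension {n} b G = record { adj = adj′ ; sym = sym′ ; irrefl = irrefl′ }
  where
  adj′ : Fin (suc n) → Fin (suc n) → Bool
  adj′ zero    zero    = false
  adj′ zero    (suc v) = b v
  adj′ (suc u) zero    = b u
  adj′ (suc u) (suc v) = adj G u v

  sym′ : ∀ u v → adj′ u v ≡ adj′ v u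
  sym′ zero    zero    = refl
  sym′ zero    (suc v) = refl
  sym′ (suc u) zero    = refl
  sym′ (suc u) (suc v) = adj-sym G u v

  irrefl′ : ∀ u → adj′ u u ≡ false
  irrefl′ zero    = refl
  irrefl′ (suc u) = adj-irrefl G u

extension-↪ : (G : Graph (suc n)) {H : Graph n} (a : Fin (suc n)) (e : H ↪ delete G a) (b : Fin n → Bool) →
              (∀ i → b i ≡ adj G a (punchIn a (_↪_.to e i))) → extension b H ↪ G
extension-↪ {n} G a e b eq = record
  { to        = to′
  ; injective = injective′
  ; preserves = λ where
      zero    zero    → sym (adj-irrefl G a)
      zero    (suc j) → eq j
      (suc i) zero    → trans (eq i) (adj-sym G _ _)
      (suc i) (suc j) → preserves i j
  }
  where
  open _↪_ e

  to′ : Fin (suc n) → Fin (suc n)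
  to′ zero    = a
  to′ (suc i) = punchIn a (to i)

  injective′ : Injective _≡_ _≡_ to′
  injective′ {zero}  {zero}  _  = refl
  injective′ {zero}  {suc j} eq = contradiction (sym eq) (punchInᵢ≢i a _)
  injective′ {suc i} {zero}  eq = contradiction eq (punchInᵢ≢i a _)
  injective′ {suc i} {suc j} eq = cong suc (injective (punchIn-injective a _ _ eq))

-- Recognising small graphs

every? : {P : Fin n → Set} → (∀ i → Dec (P i)) → Dec (∀ i → P i)
every? {zero}  P? = yes λ ()
every? {suc n} P? = map′ (λ { (z , s) zero → z ; (z , s) (suc i) → s i }) (λ p → p zero , p ∘ suc)
                      (P? zero ×-dec every? (P? ∘ suc))

-- The adjacency matrix is a bound variable, so that evaluation computes each of its entries only once.
private
  fromMatrix : (G : Graph n) (M : Vec (Vec Bool n) n) →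
               (∀ u v → Vec.lookup (Vec.lookup M u) v ≡ adj G u v) → Graph n
  fromMatrix G M eq = record
    { adj    = λ u v → Vec.lookup (Vec.lookup M u) v
    ; sym    = λ u v → trans (eq u v) (trans (adj-sym G u v) (sym (eq v u)))
    ; irrefl = λ u → trans (eq u u) (adj-irrefl G u)
    }

  matrix-lookup : (G : Graph n) → ∀ u v →
                  Vec.lookup (Vec.lookup (Vec.tabulate λ u → Vec.tabulate (adj G u)) u) v ≡ adj G u v
  matrix-lookup G u v =
    trans (cong (λ row → Vec.lookup row v) (lookup∘tabulate (λ u → Vec.tabulate (adj G u)) u))
          (lookup∘tabulate (adj G u) v)

memo : Graph n → Graph n
memo G = fromMatrix G (Vec.tabulate λ u → Vec.tabulate (adj G u)) (matrix-lookup G)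

memo-↪ : (G : Graph n) → memo G ↪ G
memo-↪ G = record { to = λ u → u ; injective = λ eq → eq ; preserves = matrix-lookup G }

-- A merge is written as a two-digit number: 41 puts vertex 4 into the class of vertex 1.
merge : ℕ → Fin (suc n) × Fin (suc n)
merge d = (d / 10) mod _ , (d % 10) mod _

module _ (G : Graph (suc n)) where

  private
    V = Fin (suc n)

    module _ (roots : Vec V (suc n)) where

      root : V → V
      root = Vec.lookup roots

      open Separation G root

      misses? : ∀ v w → Dec (Misses v w)
      misses? v w = every? λ x → (root x ≟ root w) →-dec (adj G v x Bool.≟ false)

      separates? : ∀ u v → Dec (∃ (Separates u v))
      separates? u v = any? λ w → ¬? (root w ≟ root u) ×-dec
        (((adj G u w Bool.≟ true) ×-dec misses? v w) ⊎-dec ((adj G v w Bool.≟ true) ×-dec misses? u w))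

      -- Testing the merged pairs first rejects most candidates at once.
      plausible : Vec (V × V) r → Bool
      plausible []             = true
      plausible ((x , t) ∷ ms) = does (separates? x t) ∧ plausible ms

      verify : Vec V r → Maybe (Certificate G r)
      verify {r} away = Maybe.map build (dec⇒maybe (separated? ×-dec fixed? ×-dec distinct? ×-dec roots?))
        where
        absorbed : Fin r → V
        absorbed = Vec.lookup away

        -- Pairs with an absorbed vertex suffice: by `fixed?` all other vertices are their own
        -- roots, so two of them in one class coincide.
        separated? = every? λ i → every? λ v →
          ¬? (v ≟ absorbed i) →-dec ((root v ≟ root (absorbed i)) →-dec separates? (absorbed i) v)
        fixed?     = every? λ u → (root u ≟ u) ⊎-dec (any? λ i → u ≟ absorbed i)
        distinct?  = every? λ i → every? λ j → (absorbed i ≟ absorbed j) →-dec (i ≟ j)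
        roots?     = every? λ u → every? λ i → ¬? (root u ≟ absorbed i)

        build : _ → Certificate G r
        build (s , f , d , ρ) = record
          { root = root ; absorbed = absorbed ; absorbed-injective = d _ _ ; root≢absorbed = ρ ; separated = separated }
          where
          separated : ∀ u v → u ≢ v → root u ≡ root v → ∃ (Separates u v)
          separated u v u≢v same with f u | f v
          ... | inj₂ (i , refl) | _               = s i v (u≢v ∘ sym) (sym same)
          ... | inj₁ _          | inj₂ (j , refl) = let w , w≢v , sep = s j u u≢v same in
                                                    w , (λ w∼u → w≢v (trans w∼u same)) , Sum.swap sep
          ... | inj₁ u-root     | inj₁ v-root     = contradiction (trans (sym u-root) (trans same v-root)) u≢v

    fromRoots : Vec (V × V) r → Vec V (suc n) → Maybe (Certificate G r)
    fromRoots ms roots = if plausible roots ms then verify roots (Vec.map proj₁ ms) else nothing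

    fromMerges : Vec (V × V) r → Maybe (Certificate G r)
    fromMerges ms = fromRoots ms
      (Vec.tabulate λ u → Vec.foldr _ (λ (x , t) v → if does (u ≟ x) then t else v) u ms)

  certificate? : Vec ℕ r → Maybe (Certificate G r)
  certificate? codes = fromMerges (Vec.map merge codes)

firstJust : {A B : Set} → (A → Maybe B) → List A → Maybe B
firstJust f []       = nothing
firstJust f (x ∷ xs) = f x <∣> firstJust f xs

degrees : Graph n → Vec ℕ n
degrees {n} G = Vec.tabulate λ u → List.foldr (λ v d → if adj G u v then suc d else d) 0 (allFin n)

module _ (H G : Graph n) (degH degG : Vec ℕ n) where

  private
    compatible : Fin n → Fin n → List (Fin n × Fin n) → Bool
    compatible i x []             = true
    compatible i x ((j , y) ∷ as) =
      not (does (x ≟ y)) ∧ does (adj H i j Bool.≟ adj G x y) ∧ compatible i x as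

    verify : Vec (Fin n) n → Maybe (H ↪ G)
    verify images = Maybe.map (λ (inj , pre) → record { to = to ; injective = inj _ _ ; preserves = pre })
      (dec⇒maybe
        ((every? λ i → every? λ j → (to i ≟ to j) →-dec (i ≟ j)) ×-dec
         (every? λ i → every? λ j → adj H i j Bool.≟ adj G (to i) (to j))))
      where
      to : Fin n → Fin n
      to = Vec.lookup images

    -- Backtracking over the images of the vertices, pruned by degree and by adjacency to the
    -- vertices already placed. The pruning needs no correctness proof, as `verify` tests the
    -- complete map afresh.
    search : List (Fin n × Fin n) → List (Fin n) → Maybe (H ↪ G)
    search as []       = verify (Vec.tabulate λ i → List.foldr (λ (j , y) x → if does (i ≟ j) then y else x) i as)
    search as (i ∷ is) = firstJust
      (λ x → if (Vec.lookup degH i ≡ᵇ Vec.lookup degG x) ∧ compatible i x as then search ((i , x) ∷ as) is else nothing)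
      (allFin n)

  embedding : Maybe (H ↪ G)
  embedding = search [] (allFin n)

-- The decimal digit of weight `10 ^ d` counts the vertices of degree `d`. Up to order 9 no carry
-- occurs, so the key encodes the multiset of degrees.
key : Vec ℕ n → ℕ
key = Vec.foldr _ (λ d k → 10 ^ d + k) 0

record Target {A : Set} (graph : A → Graph n) : Set where
  constructor mkTarget
  field
    label   : A
    copy    : Graph n
    copy-↪  : copy ↪ graph label
    degs    : Vec ℕ n
    degsKey : ℕ

target : {A : Set} (graph : A → Graph n) → A → Target graph
target graph a = go (memo (graph a)) (memo-↪ (graph a))
  where
  go : ∀ M → M ↪ graph a → Target graph
  go M e = go′ (degrees M)
    where
    go′ : Vec ℕ _ → Target graph
    go′ d = mkTarget a M e d (key d)

-- An embedding between graphs of the same order is an isomorphism, so the second alternative means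
-- that `G` is on the list.
Outcome : {A : Set} (graph : A → Graph n) → Graph n → Set
Outcome graph G = Certificate G 3 ⊎ ∃ λ a → G ↪ graph a

outcome-resp : {A : Set} {graph : A → Graph n} {G H : Graph n} → G ↪ H → Outcome graph G → Outcome graph H
outcome-resp e (inj₁ C)       = inj₁ (certificate-↪ e C)
outcome-resp e (inj₂ (a , f)) = inj₂ (a , ↪-trans (↪-sym e) f)

module _ {A : Set} (graph : A → Graph (suc n)) (candidates : List (Vec ℕ 3)) (targets : List (Target graph)) where

  private
    certified : (G : Graph (suc n)) → Maybe (Outcome graph G)
    certified G = Maybe.map inj₁ (firstJust (certificate? G) candidates)

    listed : (G : Graph (suc n)) → Vec ℕ (suc n) → ℕ → Maybe (Outcome graph G)
    listed G d k = firstJust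
      (λ t → if k ≡ᵇ Target.degsKey t
             then Maybe.map (λ e → inj₂ (Target.label t , ↪-trans e (Target.copy-↪ t)))
                    (embedding G (Target.copy t) d (Target.degs t))
             else nothing)
      targets

    outcome : (G : Graph (suc n)) → Maybe (Outcome graph G)
    outcome G = certified G <∣> go (degrees G)
      where
      go : Vec ℕ (suc n) → Maybe (Outcome graph G)
      go d = listed G d (key d)

    viaCopy : {G : Graph (suc n)} (M : Graph (suc n)) → M ↪ G → Maybe (Outcome graph G)
    viaCopy M e = Maybe.map (outcome-resp e) (outcome M)

  classify : (G : Graph (suc n)) → Maybe (Outcome graph G)
  classify G = viaCopy (memo G) (memo-↪ G)

-- Enumeration of small graphs by extension and duplication

bit : ℕ → ℕ → Bool
bit c zero    = (c % 2) ≡ᵇ 1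
bit c (suc k) = bit (c / 2) k

-- The pair a < b is an edge when bit b (b - 1) / 2 + a of the code is set.
coded : (n : ℕ) → ℕ → Graph n
coded n c = mkGraph n (λ a b → (a <ᵇ b) ∧ bit c (triangle b + a))
  where
  triangle : ℕ → ℕ
  triangle zero    = 0
  triangle (suc b) = b + triangle b

-- One graph of each isomorphism type without a certificate that absorbs three vertices, up to order 6;
-- below order 6 these are all graphs.
codes : ℕ → List ℕ
codes 2 = 0 ∷ 1 ∷ []
codes 3 = 0 ∷ 4 ∷ 6 ∷ 7 ∷ []
codes 4 = 0 ∷ 32 ∷ 48 ∷ 56 ∷ 52 ∷ 60 ∷ 50 ∷ 62 ∷ 33 ∷ 51 ∷ 63 ∷ []
codes 5 =
  0 ∷ 512 ∷ 768 ∷ 896 ∷ 960 ∷ 800 ∷ 928 ∷ 992 ∷ 784 ∷ 944 ∷ 1008 ∷ 904 ∷ 936 ∷ 504 ∷ 1016 ∷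
  516 ∷ 788 ∷ 852 ∷ 948 ∷ 1012 ∷ 1020 ∷ 786 ∷ 946 ∷ 1010 ∷ 1022 ∷ 769 ∷ 801 ∷ 929 ∷ 993 ∷
  937 ∷ 787 ∷ 947 ∷ 1011 ∷ 1023 ∷ []
codes 6 =
  0 ∷ 16384 ∷ 30720 ∷ 31744 ∷ 16320 ∷ 32704 ∷ 29472 ∷ 31520 ∷ 32544 ∷ 16352 ∷ 32736 ∷ 31664 ∷
  32688 ∷ 32752 ∷ 31224 ∷ 32248 ∷ 32760 ∷ 31668 ∷ 32692 ∷ 32756 ∷ 32764 ∷ 31666 ∷ 32690 ∷
  32754 ∷ 31658 ∷ 31582 ∷ 32766 ∷ 29473 ∷ 31521 ∷ 32545 ∷ 16353 ∷ 32737 ∷ 31667 ∷ 32691 ∷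
  32755 ∷ 15243 ∷ 31627 ∷ 31659 ∷ 25095 ∷ 31583 ∷ 32767 ∷ []
codes _ = 0 ∷ []

-- A greedily chosen set of merges that settles every one-vertex extension (orders 6 and 7) and every
-- duplication of a vertex (orders 8 and 9) of a listed graph that is not isomorphic to a listed graph.
candidates : ℕ → List (Vec ℕ 3)
candidates 6 =
  (20 ∷ 41 ∷ 53 ∷ []) ∷ (10 ∷ 52 ∷ 43 ∷ []) ∷ (42 ∷ 52 ∷ 10 ∷ []) ∷ (10 ∷ 50 ∷ 42 ∷ []) ∷
  (40 ∷ 21 ∷ 53 ∷ []) ∷ (41 ∷ 51 ∷ 32 ∷ []) ∷ (20 ∷ 40 ∷ 31 ∷ []) ∷ (42 ∷ 52 ∷ 30 ∷ []) ∷
  (10 ∷ 40 ∷ 53 ∷ []) ∷ (10 ∷ 30 ∷ 50 ∷ []) ∷ (30 ∷ 51 ∷ 42 ∷ []) ∷ (21 ∷ 41 ∷ 51 ∷ []) ∷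
  (30 ∷ 40 ∷ 52 ∷ []) ∷ (31 ∷ 51 ∷ 40 ∷ []) ∷ (20 ∷ 50 ∷ 41 ∷ []) ∷ (10 ∷ 32 ∷ 54 ∷ []) ∷
  (31 ∷ 51 ∷ 42 ∷ []) ∷ (20 ∷ 40 ∷ 53 ∷ []) ∷ (21 ∷ 51 ∷ 40 ∷ []) ∷ []
candidates 7 =
  (40 ∷ 51 ∷ 62 ∷ []) ∷ (10 ∷ 63 ∷ 54 ∷ []) ∷ (42 ∷ 62 ∷ 53 ∷ []) ∷ (40 ∷ 62 ∷ 53 ∷ []) ∷
  (31 ∷ 52 ∷ 64 ∷ []) ∷ (31 ∷ 61 ∷ 50 ∷ []) ∷ (41 ∷ 62 ∷ 53 ∷ []) ∷ (41 ∷ 51 ∷ 63 ∷ []) ∷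
  (42 ∷ 62 ∷ 50 ∷ []) ∷ (10 ∷ 32 ∷ 64 ∷ []) ∷ (10 ∷ 40 ∷ 63 ∷ []) ∷ (60 ∷ 41 ∷ 53 ∷ []) ∷
  (20 ∷ 40 ∷ 60 ∷ []) ∷ (21 ∷ 63 ∷ 54 ∷ []) ∷ (30 ∷ 21 ∷ 64 ∷ []) ∷ (51 ∷ 61 ∷ 42 ∷ []) ∷
  (43 ∷ 53 ∷ 62 ∷ []) ∷ (42 ∷ 52 ∷ 62 ∷ []) ∷ (30 ∷ 52 ∷ 64 ∷ []) ∷ []
candidates 8 =
  (70 ∷ 51 ∷ 62 ∷ []) ∷ (10 ∷ 40 ∷ 52 ∷ []) ∷ (70 ∷ 61 ∷ 53 ∷ []) ∷ (52 ∷ 72 ∷ 61 ∷ []) ∷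
  (43 ∷ 53 ∷ 70 ∷ []) ∷ (50 ∷ 21 ∷ 74 ∷ []) ∷ []
candidates 9 =
  (70 ∷ 51 ∷ 62 ∷ []) ∷ (10 ∷ 40 ∷ 82 ∷ []) ∷ (20 ∷ 50 ∷ 83 ∷ []) ∷ (70 ∷ 61 ∷ 43 ∷ []) ∷
  (70 ∷ 61 ∷ 84 ∷ []) ∷ (20 ∷ 81 ∷ 75 ∷ []) ∷ []
candidates _ = []

allRows : ∀ n → (Vec Bool n → Bool) → Bool
allRows zero    p = p []
allRows (suc n) p = allRows n (p ∘ (true ∷_)) ∧ allRows n (p ∘ (false ∷_))

allRows-sound : ∀ n p → allRows n p ≡ true → ∀ b → p b ≡ true
allRows-sound zero    p t []          = t
allRows-sound (suc n) p t (true ∷ b)  = allRows-sound n _ (proj₁ (∧⁻ _ t)) b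
allRows-sound (suc n) p t (false ∷ b) = allRows-sound n _ (proj₂ (∧⁻ (allRows n (p ∘ (true ∷_))) t)) b

allVertices : (Fin n → Bool) → Bool
allVertices {zero}  p = true
allVertices {suc n} p = p zero ∧ allVertices (p ∘ suc)

allVertices-sound : (p : Fin n → Bool) → allVertices p ≡ true → ∀ i → p i ≡ true
allVertices-sound p t zero    = proj₁ (∧⁻ _ t)
allVertices-sound p t (suc i) = allVertices-sound (p ∘ suc) (proj₂ (∧⁻ (p zero) t)) i

fromJust : {A : Set} (x : Maybe A) → is-just x ≡ true → A
fromJust (just a) _ = a

graphs : ∀ n → Fin (List.length (codes n)) → Graph n
graphs n i = coded n (List.lookup (codes n) i)

module _ {k k′} (graph : Fin k → Graph n) (graph′ : Fin k′ → Graph (suc n)) where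

  targets : List (Target graph′)
  targets = List.map (target graph′) (allFin k′)

  opaque
    -- Opaque, so that the search is evaluated only in the proofs by `refl` that unfold it.
    recognised : List (Target graph′) → Graph (suc n) → Bool
    recognised ts X = is-just (classify graph′ (candidates (suc n)) ts X)

    recognised-sound : ∀ ts X → recognised ts X ≡ true → Outcome graph′ X
    recognised-sound ts X = fromJust (classify graph′ (candidates (suc n)) ts X)

  extensionsRecognised : List (Target graph′) → Graph n → Bool
  extensionsRecognised ts M = allRows n λ b → recognised ts (extension (Vec.lookup b) M)

  extensionCheck : List (Target graph′) → Bool
  extensionCheck ts = allVertices λ a → extensionsRecognised ts (memo (graph a))

  -- A certificate of `G` minus vertex zero extends to `G`. Otherwise this subgraph is listed, and
  -- `G` is its extension by the adjacency row of vertex zero, one of the rows that the check runs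
  -- through.
  extensionStep : extensionCheck targets ≡ true → (∀ G → Outcome graph G) → ∀ G → Outcome graph′ G
  extensionStep ok IH G = [ (λ C → inj₁ (certificate-↪ (delete-↪ G zero) C)) , extend ]′ (IH (delete G zero))
    where
    extend : (∃ λ a → delete G zero ↪ graph a) → Outcome graph′ G
    extend (a , e) = outcome-resp
      (extension-↪ G zero e′ (Vec.lookup b) (lookup∘tabulate (adj G zero ∘ suc ∘ _↪_.to e′)))
      (recognised-sound targets (extension (Vec.lookup b) M)
        (allRows-sound n (λ b → recognised targets (extension (Vec.lookup b) M))
          (allVertices-sound (λ a → extensionsRecognised targets (memo (graph a))) ok a) b))
      where
      M : Graph n
      M = memo (graph a)

      e′ : M ↪ delete G zero
      e′ = ↪-trans (memo-↪ (graph a)) (↪-sym e)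

      b : Vec Bool n
      b = Vec.tabulate (adj G zero ∘ suc ∘ _↪_.to e′)

-- The new vertex zero is a twin of `p`, adjacent to `p` exactly when `e` is `true`.
duplicate : Graph n → Fin n → Bool → Graph (suc n)
duplicate H p e = extension (λ q → if does (q ≟ p) then e else adj H p q) H

module _ {k k′} (graph : Fin k → Graph n) (graph′ : Fin k′ → Graph (suc n)) where

  duplicatesRecognised : List (Target graph′) → Graph n → Bool
  duplicatesRecognised ts M = allVertices λ p →
    recognised graph graph′ ts (duplicate M p true) ∧ recognised graph graph′ ts (duplicate M p false)

  duplicateCheck : List (Target graph′) → Bool
  duplicateCheck ts = allVertices λ a → duplicatesRecognised ts (memo (graph a))

  duplicateOutcome : duplicateCheck (targets graph graph′) ≡ true →
                     ∀ a p s → Outcome graph′ (duplicate (memo (graph a)) p s)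
  duplicateOutcome ok a p s =
    recognised-sound graph graph′ ts (duplicate (memo (graph a)) p s) (either s)
    where
    ts : List (Target graph′)
    ts = targets graph graph′

    accepted : Bool → Bool
    accepted s = recognised graph graph′ ts (duplicate (memo (graph a)) p s)

    both : accepted true ∧ accepted false ≡ true
    both = allVertices-sound
      (λ p → recognised graph graph′ ts (duplicate (memo (graph a)) p true)
           ∧ recognised graph graph′ ts (duplicate (memo (graph a)) p false))
      (allVertices-sound (λ a → duplicatesRecognised ts (memo (graph a))) ok a) p

    either : ∀ s → accepted s ≡ true
    either true  = proj₁ (∧⁻ (accepted true) both)
    either false = proj₂ (∧⁻ (accepted true) both)

-- Families of graphs

-- The positions from 4 on form the homogeneous part: the relation does not tell them apart.
record Family : Set where
  constructor mkFamily
  field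
    relation : ℕ → ℕ → Bool
    stableˡ  : ∀ a b → relation (4 + a) b ≡ relation 4 b
    stableʳ  : ∀ a b → relation a (4 + b) ≡ relation a 4

  member : (n : ℕ) → Graph n
  member n = mkGraph n relation
open Family public

-- H1, …, H11, H13, …, H16.
partitionDimension-n-2 : Vec Family 15
partitionDimension-n-2 =
    mkFamily (λ a b → (a == 0 ∧ b == 1) ∨ b ≥ 3) (λ _ _ → refl) (λ _ _ → refl)
  ∷ mkFamily (λ a b → b ≥ 3) (λ _ _ → refl) (λ _ _ → refl)
  ∷ mkFamily (λ a b → (a == 0 ∧ b == 1) ∨ (a == 1 ∧ b == 2) ∨ (a == 2 ∧ b == 3) ∨ (a == 3 ∧ b == 0) ∨ b ≥ 4)
      (λ _ _ → refl) (λ _ _ → refl)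
  ∷ mkFamily (λ a b → (a == 0 ∧ b == 1) ∨ (a == 1 ∧ b == 2) ∨ (a == 2 ∧ b == 3) ∨ b ≥ 4)
      (λ _ _ → refl) (λ _ _ → refl)
  ∷ mkFamily (λ a b → (a == 0 ∧ b == 1) ∨ (a == 2 ∧ b == 3) ∨ b ≥ 4) (λ _ _ → refl) (λ _ _ → refl)
  ∷ mkFamily (λ a b → (a <ᵇ 2) ∧ b ≥ 2) (λ _ _ → refl) (λ _ _ → refl)
  ∷ mkFamily (λ a b → a <ᵇ 2) (λ _ _ → refl) (λ _ _ → refl)
  ∷ mkFamily (λ a b → (a <ᵇ 2) ∨ (a ≥ 3 ∧ b ≥ 3)) (λ _ _ → refl) (λ _ _ → refl)
  ∷ mkFamily (λ a b → ((a <ᵇ 2) ∧ b ≥ 2) ∨ (a ≥ 3 ∧ b ≥ 3)) (λ _ _ → refl) (λ _ _ → refl)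
  ∷ mkFamily (λ a b → a == 0 ∨ (a == 1 ∧ b == 2) ∨ (a ≥ 3 ∧ b ≥ 3)) (λ _ _ → refl) (λ _ _ → refl)
  ∷ mkFamily (λ a b → (a == 0 ∧ b == 1) ∨ (a == 1 ∧ b == 2) ∨ ((2 ≥ a) ∧ b ≥ 3 ∧ not (a == 0 ∧ b == 3))
                   ∨ (a ≥ 4 ∧ b ≥ 4))
      (λ _ _ → refl) (λ _ _ → refl)
  ∷ mkFamily (λ a b → a == 0 ∨ (a ≥ 3 ∧ b ≥ 3)) (λ _ _ → refl) (λ _ _ → refl)
  ∷ mkFamily (λ a b → a == 0 ∨ (a ≥ 2 ∧ b ≥ 2 ∧ not ((a == 2 ∧ b == 3) ∨ (a == 3 ∧ b == 2))))
      (λ _ _ → refl) (λ _ _ → refl)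
  ∷ mkFamily (λ a b → (a == 0 ∧ b == 2) ∨ (a ≥ 1 ∧ b ≥ 3)) (λ _ _ → refl) (λ _ _ → refl)
  ∷ mkFamily (λ a b → (a == 0 ∧ b == 1) ∨ (a == 1 ∧ b == 2) ∨ (a ≥ 2 ∧ b ≥ 3))
      (λ _ _ → refl) (λ _ _ → refl)
  ∷ []

-- K_n, K_{1,n-1}, K_n minus an edge, and K_1 ∨ (K_1 + K_{n-2}).
larger : Vec Family 4
larger =
    mkFamily (λ a b → true) (λ _ _ → refl) (λ _ _ → refl)
  ∷ mkFamily (λ a b → a == 0) (λ _ _ → refl) (λ _ _ → refl)
  ∷ mkFamily (λ a b → b ≥ 2) (λ _ _ → refl) (λ _ _ → refl)
  ∷ mkFamily (λ a b → a == 0 ∨ (a ≥ 2 ∧ b ≥ 2)) (λ _ _ → refl) (λ _ _ → refl)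
  ∷ []

-- The edgeless graph, K_2 plus isolated vertices, K_1 + K_{1,n-2}, two isolated vertices plus K_{n-2},
-- K_1 + (K_1 ∨ (K_1 + K_{n-3})), K_1 + (K_{n-1} minus an edge), K_1 + K_{n-1}, and K_2 + K_{n-2}.
disconnected : Vec Family 8
disconnected =
    mkFamily (λ a b → false) (λ _ _ → refl) (λ _ _ → refl)
  ∷ mkFamily (λ a b → a == 0 ∧ b == 1) (λ _ _ → refl) (λ _ _ → refl)
  ∷ mkFamily (λ a b → a == 1 ∧ b ≥ 2) (λ _ _ → refl) (λ _ _ → refl)
  ∷ mkFamily (λ a b → a ≥ 2 ∧ b ≥ 2) (λ _ _ → refl) (λ _ _ → refl)
  ∷ mkFamily (λ a b → (a == 1 ∧ b ≥ 2) ∨ (a ≥ 3 ∧ b ≥ 3)) (λ _ _ → refl) (λ _ _ → refl)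
  ∷ mkFamily (λ a b → a ≥ 1 ∧ b ≥ 3) (λ _ _ → refl) (λ _ _ → refl)
  ∷ mkFamily (λ a b → a ≥ 1 ∧ b ≥ 1) (λ _ _ → refl) (λ _ _ → refl)
  ∷ mkFamily (λ a b → (a == 0 ∧ b == 1) ∨ (a ≥ 2 ∧ b ≥ 2)) (λ _ _ → refl) (λ _ _ → refl)
  ∷ []

families : Vec Family 27
families = partitionDimension-n-2 ++ larger ++ disconnected

members : ∀ n → Fin 27 → Graph n
members n i = member (Vec.lookup families i) n

module _ (F : Family) where

  linked : ℕ → ℕ → Bool
  linked a b = relation F a b ∨ relation F b a

  linked-comm : ∀ a b → linked a b ≡ linked b a
  linked-comm a b = Bool.∨-comm (relation F a b) (relation F b a)

  linked-far : ∀ a b → 4 ≤ a → linked a b ≡ linked 4 b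
  linked-far _ b (s≤s (s≤s (s≤s (s≤s {n = a} z≤n)))) = cong₂ _∨_ (stableˡ F a b) (stableʳ F b a)

  linked-farʳ : ∀ a b → 4 ≤ b → linked a b ≡ linked a 4
  linked-farʳ a b 4≤b = trans (linked-comm a b) (trans (linked-far b a 4≤b) (linked-comm 4 a))

  -- Position 4 represents all later ones. Capping at 4 turns conditions on positions of any order
  -- into finite checks over `Fin 5`.
  linked-⊓ : ∀ a b → linked a b ≡ linked a (b ⊓ 4)
  linked-⊓ a b with b <? 4
  ... | yes b<4 = cong (linked a) (sym (m≤n⇒m⊓n≡m (<⇒≤ b<4)))
  ... | no  b≮4 = trans (linked-farʳ a b (≮⇒≥ b≮4)) (cong (linked a) (sym (m≥n⇒m⊓n≡n (≮⇒≥ b≮4))))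

  adj-member : {u v : Fin n} → u ≢ v → adj (member F n) u v ≡ linked (toℕ u) (toℕ v)
  adj-member {u = u} {v} u≢v with toℕ u ≡ᵇ toℕ v in eq
  ... | true  = contradiction (toℕ-injective (≡ᵇ⇒≡ (toℕ u) (toℕ v) (subst T (sym eq) _))) u≢v
  ... | false = refl

  member-mono : m ≤ n → member F m ↪ member F n
  member-mono m≤n = record
    { to        = λ i → inject≤ i m≤n
    ; injective = inject≤-injective m≤n m≤n _ _
    ; preserves = λ i j → sym (cong₂ (λ a b → not (a ≡ᵇ b) ∧ linked a b) (toℕ-inject≤ i m≤n) (toℕ-inject≤ j m≤n))
    }

  -- The duplicate of a vertex that looks like the homogeneous part enlarges that part by one.
  absorb : (p : Fin n) {e : Bool} → 4 ≤ n → (∀ q → q ≢ toℕ p → linked (toℕ p) q ≡ linked 4 q) → e ≡ linked 4 (toℕ p) →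
           duplicate (member F n) p e ↪ member F (suc n)
  absorb {n} p {e} 4≤n same e≡ = record { to = to ; injective = injective ; preserves = preserves }
    where
    to : Fin (suc n) → Fin (suc n)
    to zero    = fromℕ n
    to (suc q) = inject₁ q

    injective : Injective _≡_ _≡_ to
    injective {zero}  {zero}  _  = refl
    injective {zero}  {suc j} eq = contradiction eq fromℕ≢inject₁
    injective {suc i} {zero}  eq = contradiction (sym eq) fromℕ≢inject₁
    injective {suc i} {suc j} eq = cong suc (inject₁-injective eq)

    new : ∀ q → (if does (q ≟ p) then e else adj (member F n) p q) ≡ adj (member F (suc n)) (fromℕ n) (inject₁ q)
    new q = trans old (sym (trans (adj-member fromℕ≢inject₁)
              (trans (cong₂ linked (toℕ-fromℕ n) (toℕ-inject₁ q)) (linked-far n (toℕ q) 4≤n))))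
      where
      old : (if does (q ≟ p) then e else adj (member F n) p q) ≡ linked 4 (toℕ q)
      old with q ≟ p
      ... | yes refl = e≡
      ... | no q≢p   = trans (adj-member (q≢p ∘ sym)) (same (toℕ q) (q≢p ∘ toℕ-injective))

    preserves : ∀ i j → adj (duplicate (member F n) p e) i j ≡ adj (member F (suc n)) (to i) (to j)
    preserves zero    zero    = sym (adj-irrefl (member F (suc n)) (fromℕ n))
    preserves zero    (suc q) = new q
    preserves (suc q) zero    = trans (new q) (adj-sym (member F (suc n)) (fromℕ n) (inject₁ q))
    preserves (suc i) (suc j) = sym (cong₂ (λ a b → not (a ≡ᵇ b) ∧ linked a b) (toℕ-inject₁ i) (toℕ-inject₁ j))

-- Adding a twin

Twins : Graph n → Fin n → Fin n → Set
Twins G a b = ∀ x → x ≢ a → x ≢ b → adj G a x ≡ adj G b x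

duplicate-↪ : (G : Graph (suc n)) {H : Graph n} {a b : Fin (suc n)} → Twins G a b →
              (e : H ↪ delete G a) (p : Fin n) → punchIn a (_↪_.to e p) ≡ b →
              duplicate H p (adj G a b) ↪ G
duplicate-↪ G {H} {a} {b} twins e p p↦b = extension-↪ G a e _ row
  where
  open _↪_ e
  row : ∀ i → (if does (i ≟ p) then adj G a b else adj H p i) ≡ adj G a (punchIn a (to i))
  row i with i ≟ p
  ... | yes refl = cong (adj G a) (sym p↦b)
  ... | no i≢p   = trans (preserves p i) (trans (cong (λ v → adj G v (punchIn a (to i))) p↦b)
        (sym (twins _ (punchInᵢ≢i a _) (λ eq → i≢p (injective (punchIn-injective a _ _ (trans eq (sym p↦b))))))))

module Homogeneous (F : Family) {m} (G : Graph (suc (4 + m))) (e : member F (4 + m) ↪ delete G zero) where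

  open _↪_ e
  open Inverted e

  vertex : Fin m → Fin (suc (4 + m))
  vertex i = suc (to (4 ↑ʳ i))

  vertex-injective : ∀ {i j} → vertex i ≡ vertex j → i ≡ j
  vertex-injective {i} {j} eq = ↑ʳ-injective 4 i j (injective (suc-injective eq))

  private
    far : ∀ (i : Fin m) → 4 ≤ toℕ (4 ↑ʳ i)
    far i = subst (4 ≤_) (sym (toℕ-↑ʳ 4 i)) (m≤m+n 4 _)

  vertex-adj : ∀ {i j} → i ≢ j → adj G (vertex i) (vertex j) ≡ linked F 4 4
  vertex-adj {i} {j} i≢j = trans (sym (preserves (4 ↑ʳ i) (4 ↑ʳ j)))
    (trans (adj-member F (i≢j ∘ ↑ʳ-injective 4 i j))
      (trans (linked-far F _ _ (far i)) (linked-farʳ F 4 _ (far j))))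

  -- Inside `G` minus vertex zero the homogeneous vertices already agree on every other vertex, so
  -- vertex zero is the only one that could tell them apart.
  vertex-twins : ∀ i j → adj G zero (vertex i) ≡ adj G zero (vertex j) → Twins G (vertex i) (vertex j)
  vertex-twins i j same zero    _   _   = trans (adj-sym G _ _) (trans same (adj-sym G _ _))
  vertex-twins i j same (suc x) x≢i x≢j =
    trans (row i x≢i) (sym (row j x≢j))
    where
    row : ∀ i → suc x ≢ vertex i → adj G (vertex i) (suc x) ≡ linked F 4 (toℕ (from x))
    row i x≢i = trans (cong (λ y → adj G (vertex i) (suc y)) (sym (to-from x)))
      (trans (sym (preserves (4 ↑ʳ i) (from x)))
        (trans (adj-member F (λ eq → x≢i (cong suc (trans (sym (to-from x)) (cong to (sym eq))))))
          (linked-far F _ _ (far i))))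

pigeonhole₃ : (f : Fin 3 → Bool) → ∃₂ λ i j → i ≢ j × f i ≡ f j
pigeonhole₃ f with f zero Bool.≟ f (suc zero) | f zero Bool.≟ f (suc (suc zero))
... | yes eq | _      = zero , suc zero , (λ ()) , eq
... | no _   | yes eq = zero , suc (suc zero) , (λ ()) , eq
... | no ≢₁  | no ≢₂  = suc zero , suc (suc zero) , (λ ()) ,
                        trans (Bool.¬-not (≢₁ ∘ sym)) (sym (Bool.¬-not (≢₂ ∘ sym)))

record Triple (f : Fin 5 → Bool) : Set where
  field
    i₁ i₂ i₃ i₄ : Fin 5
    distinct    : i₁ ≢ i₂ × i₁ ≢ i₃ × i₁ ≢ i₄ × i₂ ≢ i₃ × i₂ ≢ i₄ × i₃ ≢ i₄
    constant    : f i₁ ≡ f i₂ × f i₁ ≡ f i₃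

private
  triple? : (b : Vec Bool 5) → Maybe (Triple (Vec.lookup b))
  triple? b = Maybe.map
    (λ (i₁ , i₂ , i₃ , i₄ , d , c) →
      record { i₁ = i₁ ; i₂ = i₂ ; i₃ = i₃ ; i₄ = i₄ ; distinct = d ; constant = c })
    (dec⇒maybe (any? λ i₁ → any? λ i₂ → any? λ i₃ → any? λ i₄ →
      (¬? (i₁ ≟ i₂) ×-dec ¬? (i₁ ≟ i₃) ×-dec ¬? (i₁ ≟ i₄) ×-dec
       ¬? (i₂ ≟ i₃) ×-dec ¬? (i₂ ≟ i₄) ×-dec ¬? (i₃ ≟ i₄)) ×-dec
      (Vec.lookup b i₁ Bool.≟ Vec.lookup b i₂) ×-dec (Vec.lookup b i₁ Bool.≟ Vec.lookup b i₃)))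

-- Two values on five indices: one of them occurs three times. The index `i₄` only has to differ
-- from these three. All 32 cases are evaluated.
pigeonhole₅ : (f : Fin 5 → Bool) → Triple f
pigeonhole₅ f = record
  { Triple t
  ; constant = trans (sym (eq i₁)) (trans (proj₁ constant) (eq i₂)) , trans (sym (eq i₁)) (trans (proj₂ constant) (eq i₃))
  }
  where
  t : Triple (Vec.lookup (Vec.tabulate f))
  t = fromJust (triple? (Vec.tabulate f)) (allRows-sound 5 (is-just ∘ triple?) refl (Vec.tabulate f))
  open Triple t
  eq : ∀ i → Vec.lookup (Vec.tabulate f) i ≡ f i
  eq = lookup∘tabulate f

duplicate-mono : {H : Graph m} {G : Graph n} (h : H ↪ G) (p : Fin m) (e : Bool) →
                 duplicate H p e ↪ duplicate G (_↪_.to h p) e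
duplicate-mono {m} {n} {H} {G} h p e = record
  { to        = to′
  ; injective = injective′
  ; preserves = λ where
      zero    zero    → refl
      zero    (suc j) → row j
      (suc i) zero    → row i
      (suc i) (suc j) → preserves i j
  }
  where
  open _↪_ h
  to′ : Fin (suc m) → Fin (suc n)
  to′ zero    = zero
  to′ (suc i) = suc (to i)

  injective′ : Injective _≡_ _≡_ to′
  injective′ {zero}  {zero}  _  = refl
  injective′ {suc i} {suc j} eq = cong suc (injective (suc-injective eq))

  row : ∀ j → (if does (j ≟ p) then e else adj H p j) ≡ (if does (to j ≟ to p) then e else adj G (to p) (to j))
  row j with j ≟ p
  ... | yes refl rewrite dec-true (to j ≟ to j) refl = refl
  ... | no j≢p   rewrite dec-false (to j ≟ to p) (j≢p ∘ injective) = preserves p j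

-- Without the vertex x, duplicating one of the two non-adjacent vertices of K_n minus an edge would turn it into H2.
module _ (F : Family) (p q : Fin 4) where

  private
    link : ℕ → ℕ → Bool
    link = linked F

  CoreTwins : Set
  CoreTwins = toℕ p ≢ toℕ q
    × (∃ λ (x : Fin 5) → toℕ x ≢ toℕ p × toℕ x ≢ toℕ q × link (toℕ p) (toℕ x) ≡ link (toℕ p) (toℕ q))
    × (∀ (x : Fin 5) → toℕ x ≢ toℕ p → toℕ x ≢ toℕ q → link (toℕ p) (toℕ x) ≡ link (toℕ q) (toℕ x))

  coreTwins? : Dec CoreTwins
  coreTwins? = ¬? (toℕ p ℕ.≟ toℕ q)
    ×-dec (any? λ x → ¬? (toℕ x ℕ.≟ toℕ p) ×-dec ¬? (toℕ x ℕ.≟ toℕ q) ×-dec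
                      (link (toℕ p) (toℕ x) Bool.≟ link (toℕ p) (toℕ q)))
    ×-dec (every? λ x → ¬? (toℕ x ℕ.≟ toℕ p) →-dec (¬? (toℕ x ℕ.≟ toℕ q) →-dec
                        (link (toℕ p) (toℕ x) Bool.≟ link (toℕ q) (toℕ x))))

  Absorbable : Set
  Absorbable = (∀ (x : Fin 5) → toℕ x ≢ toℕ p → link (toℕ p) (toℕ x) ≡ link 4 (toℕ x))
    × link (toℕ p) (toℕ q) ≡ link 4 (toℕ p)

  absorbable? : Dec Absorbable
  absorbable? = (every? λ x → ¬? (toℕ x ℕ.≟ toℕ p) →-dec (link (toℕ p) (toℕ x) Bool.≟ link 4 (toℕ x)))
    ×-dec (link (toℕ p) (toℕ q) Bool.≟ link 4 (toℕ p))

  -- The vertex to be added is a twin of both `p` and `q`, so its edge to `p` agrees with the edge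
  -- between `q` and `p`; this fixes the Boolean of the duplicate. A certificate found over the
  -- member of order 7 passes to larger members by embedding.
  TripledTwins : Set
  TripledTwins = Absorbable ⊎ Certificate (duplicate (member F 7) (p Fin.↑ˡ 3) (link (toℕ p) (toℕ q))) 3

  tripledTwins? : Maybe (CoreTwins → TripledTwins)
  tripledTwins? with coreTwins? | absorbable?
  ... | no ¬twins | _     = just λ twins → contradiction twins ¬twins
  ... | yes _     | yes a = just λ _ → inj₁ a
  ... | yes _     | no _  = Maybe.map (λ C _ → inj₂ C)
    (firstJust (certificate? (duplicate (member F 7) (p Fin.↑ˡ 3) (link (toℕ p) (toℕ q)))) (candidates 8))

tripledTwinsAt : Fin 27 → Fin 4 → Fin 4 → Bool
tripledTwinsAt i p q = is-just (tripledTwins? (Vec.lookup families i) p q)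

tripledTwins : ∀ i p q → CoreTwins (Vec.lookup families i) p q → TripledTwins (Vec.lookup families i) p q
tripledTwins i p q = fromJust (tripledTwins? (Vec.lookup families i) p q)
  (allVertices-sound (tripledTwinsAt i p)
    (allVertices-sound (λ p → allVertices (tripledTwinsAt i p))
      (allVertices-sound (λ i → allVertices λ p → allVertices (tripledTwinsAt i p)) refl i) p) q)

family : Fin 27 → Family
family = Vec.lookup families

position : (G : Graph (suc n)) {H : Graph n} {a : Fin (suc n)} (e : H ↪ delete G a) (b : Fin (suc n)) →
           a ≢ b → ∃ λ p → punchIn a (_↪_.to e p) ≡ b
position G {a = a} e b a≢b = from (punchOut a≢b) , trans (cong (punchIn a) (to-from _)) (punchIn-punchOut a≢b)
  where open Inverted e

DuplicatesListed : ℕ → Set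
DuplicatesListed m =
  duplicateCheck (members (7 + m)) (members (8 + m)) (targets (members (7 + m)) (members (8 + m))) ≡ true

-- If `G` minus vertex zero is listed, it has at least three homogeneous vertices, and two of them
-- agree about vertex zero. They are twins in `G`. Deleting one leaves, by hypothesis, a graph with
-- a certificate or a listed graph; in the latter case `G` duplicates some vertex of it, which the
-- check has covered.
duplicateStep : ∀ m → DuplicatesListed m →
                (∀ G → Outcome (members (7 + m)) G) → ∀ G → Outcome (members (8 + m)) G
duplicateStep m ok IH G = [ inj₁ ∘ certificate-↪ (delete-↪ G zero) , first ]′ (IH (delete G zero))
  where
  second : ∀ {a b} → a ≢ b → Twins G a b → (∃ λ i → delete G a ↪ members (7 + m) i) → Outcome (members (8 + m)) G
  second {a} {b} a≢b twins (i , e) = attach (position G e′ b a≢b)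
    where
    M : Graph (7 + m)
    M = memo (members (7 + m) i)

    e′ : M ↪ delete G a
    e′ = ↪-trans (memo-↪ (members (7 + m) i)) (↪-sym e)

    attach : (∃ λ p → punchIn a (_↪_.to e′ p) ≡ b) → Outcome (members (8 + m)) G
    attach (p , p↦b) = outcome-resp {G = duplicate M p (adj G a b)} (duplicate-↪ G twins e′ p p↦b)
      (duplicateOutcome (members (7 + m)) (members (8 + m)) ok i p (adj G a b))

  first : (∃ λ i → delete G zero ↪ members (7 + m) i) → Outcome (members (8 + m)) G
  first (i , e) =
    [ inj₁ ∘ certificate-↪ (delete-↪ G _)
    , second (q≢q′ ∘ ↑ˡ-injective m _ _ ∘ vertex-injective) (vertex-twins _ _ same) ]′ (IH (delete G (vertex (q ↑ˡ m))))
    where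
    open Homogeneous (family i) {3 + m} G (↪-sym e)
    found = pigeonhole₃ (λ q → adj G zero (vertex (q ↑ˡ m)))
    q     = proj₁ found
    q≢q′  = proj₁ (proj₂ (proj₂ found))
    same  = proj₂ (proj₂ (proj₂ found))

module _ {m} (G : Graph (suc (9 + m))) (a : Fin (suc (9 + m))) (i : Fin 27)
         (e : members (9 + m) i ↪ delete G a) where

  private
    F    = family i
    link = linked F

    at : Fin (9 + m) → Fin (suc (9 + m))
    at p = punchIn a (_↪_.to e p)

    at≢a : ∀ p → at p ≢ a
    at≢a p = punchInᵢ≢i a _

    at-injective : ∀ {p q} → at p ≡ at q → p ≡ q
    at-injective = _↪_.injective e ∘ punchIn-injective a _ _

    link-at : ∀ {p q} → p ≢ q → link (toℕ p) (toℕ q) ≡ adj G (at p) (at q)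
    link-at {p} {q} p≢q = trans (sym (adj-member F p≢q)) (_↪_.preserves e p q)

    module _ {p q : Fin (9 + m)} (twins-p : Twins G a (at p)) (twins-q : Twins G a (at q)) (p≢q : p ≢ q) where

      alike : ∀ {x} → x ≢ p → x ≢ q → link (toℕ p) (toℕ x) ≡ link (toℕ q) (toℕ x)
      alike {x} x≢p x≢q = trans (link-at (x≢p ∘ sym)) (trans
        (trans (sym (twins-p (at x) (at≢a x) (x≢p ∘ at-injective))) (twins-q (at x) (at≢a x) (x≢q ∘ at-injective)))
        (sym (link-at (x≢q ∘ sym))))

      link-a : adj G a (at p) ≡ link (toℕ q) (toℕ p)
      link-a = trans (twins-q (at p) (at≢a p) (p≢q ∘ at-injective)) (sym (link-at (p≢q ∘ sym)))

      rebuilt : (∀ x → x ≢ toℕ p → link (toℕ p) x ≡ link 4 x) → adj G a (at p) ≡ link 4 (toℕ p) →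
                Outcome (members (suc (9 + m))) G
      rebuilt same eq = inj₂ (i , ↪-trans (↪-sym (duplicate-↪ G twins-p e p refl)) (absorb F p (m≤m+n 4 _) same eq))

      -- Only the edge between `a` and `p` must be compared with the homogeneous part. It agrees
      -- with the edge between `q` and `p`, as `a` and `q` are twins. If `q` lies in the core, a
      -- homogeneous vertex other than `p`, which `p` and `q` see alike, shows that its value is
      -- `linked F 4 4`.
      far : 4 ≤ toℕ p → Outcome (members (suc (9 + m))) G
      far 4≤p = rebuilt (λ x _ → linked-far F (toℕ p) x 4≤p)
        (trans link-a (trans (linked-farʳ F (toℕ q) (toℕ p) 4≤p) (trans q∼4 (sym (linked-farʳ F 4 (toℕ p) 4≤p)))))
        where
        other : ∃ λ (x : Fin (9 + m)) → x ≢ p × 4 ≤ toℕ x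
        other with p ≟ (4 ↑ʳ zero)
        ... | yes refl = 4 ↑ʳ suc zero , (λ ()) , m≤m+n 4 _
        ... | no p≢4   = 4 ↑ʳ zero , p≢4 ∘ sym , ≤-refl

        q∼4 : link (toℕ q) 4 ≡ link 4 4
        q∼4 with toℕ q <? 4
        ... | no q≮4  = linked-far F (toℕ q) 4 (≮⇒≥ q≮4)
        ... | yes q<4 = let x , x≢p , 4≤x = other in
          trans (sym (linked-farʳ F (toℕ q) (toℕ x) 4≤x))
            (trans (sym (alike x≢p (λ eq → n≮n 4 (≤-trans (s≤s (subst (λ z → 4 ≤ toℕ z) eq 4≤x)) q<4))))
              (trans (linked-far F (toℕ p) (toℕ x) 4≤p) (linked-farʳ F 4 (toℕ x) 4≤x)))

      -- After capping positions, `p`, `q` and the third vertex `x` form an instance of the finite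
      -- table `tripledTwins`. Its entry shows either that `p` looks homogeneous, so that the
      -- duplicate joins this part, or that an induced subgraph of `G` has a certificate.
      near : toℕ p < 4 → toℕ q < 4 → ∀ {x} → x ≢ p → x ≢ q → link (toℕ p) (toℕ x) ≡ link (toℕ p) (toℕ q) →
             Outcome (members (suc (9 + m))) G
      near p<4 q<4 {x} x≢p x≢q common = conclude (tripledTwins i p̂ q̂ (core p̂ q̂ (toℕ-fromℕ< p<4) (toℕ-fromℕ< q<4)))
        where
        p̂ = fromℕ< p<4
        q̂ = fromℕ< q<4

        cap : Fin (9 + m) → Fin 5
        cap y = fromℕ< (s≤s (m⊓n≤n (toℕ y) 4))

        toℕ-cap : ∀ y → toℕ (cap y) ≡ toℕ y ⊓ 4
        toℕ-cap y = toℕ-fromℕ< (s≤s (m⊓n≤n (toℕ y) 4))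

        cap-≢ : ∀ {y r} → toℕ r < 4 → y ≢ r → toℕ (cap y) ≢ toℕ r
        cap-≢ {y} {r} r<4 y≢r eq with toℕ y <? 4
        ... | yes y<4 = y≢r (toℕ-injective (trans (sym (m≤n⇒m⊓n≡m (<⇒≤ y<4))) (trans (sym (toℕ-cap y)) eq)))
        ... | no  y≮4 = <⇒≢ r<4 (trans (sym eq) (trans (toℕ-cap y) (m≥n⇒m⊓n≡n (≮⇒≥ y≮4))))

        lift : Fin 5 → Fin (9 + m)
        lift y = inject≤ y (m≤m+n 5 _)

        lift-≢ : ∀ {y r} → toℕ y ≢ toℕ r → lift y ≢ r
        lift-≢ {y} y≢r eq = y≢r (trans (sym (toℕ-inject≤ y (m≤m+n 5 _))) (cong toℕ eq))

        core : ∀ p̂ q̂ → toℕ p̂ ≡ toℕ p → toℕ q̂ ≡ toℕ q → CoreTwins F p̂ q̂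
        core p̂ q̂ eqp eqq rewrite eqp | eqq =
            p≢q ∘ toℕ-injective
          , (cap x , cap-≢ p<4 x≢p , cap-≢ q<4 x≢q ,
             trans (cong (link (toℕ p)) (toℕ-cap x)) (trans (sym (linked-⊓ F (toℕ p) (toℕ x))) common))
          , λ y y≢p y≢q → subst (λ z → link (toℕ p) z ≡ link (toℕ q) z) (toℕ-inject≤ y (m≤m+n 5 _))
                            (alike (lift-≢ y≢p) (lift-≢ y≢q))

        conclude : TripledTwins F p̂ q̂ → Outcome (members (suc (9 + m))) G
        conclude (inj₁ (same , eq)) rewrite toℕ-fromℕ< p<4 | toℕ-fromℕ< q<4 = rebuilt
          (λ x x≢p → trans (linked-⊓ F (toℕ p) x) (trans (capped x x≢p) (sym (linked-⊓ F 4 x))))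
          (trans link-a (trans (linked-comm F (toℕ q) (toℕ p)) eq))
          where
          capped : ∀ x → x ≢ toℕ p → link (toℕ p) (x ⊓ 4) ≡ link 4 (x ⊓ 4)
          capped x x≢p = subst (λ z → link (toℕ p) z ≡ link 4 z) x̂ (same (fromℕ< (s≤s (m⊓n≤n x 4))) distinct)
            where
            x̂ = toℕ-fromℕ< (s≤s (m⊓n≤n x 4))
            distinct : toℕ (fromℕ< (s≤s (m⊓n≤n x 4))) ≢ toℕ p
            distinct eq with x <? 4
            ... | yes x<4 = x≢p (trans (sym (m≤n⇒m⊓n≡m (<⇒≤ x<4))) (trans (sym x̂) eq))
            ... | no  x≮4 = <⇒≢ p<4 (trans (sym eq) (trans x̂ (m≥n⇒m⊓n≡n (≮⇒≥ x≮4))))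
        conclude (inj₂ C) = inj₁ (certificate-↪ X↪G C)
          where
          7≤ = m≤m+n 7 (2 + m)

          p≡ : inject≤ (p̂ ↑ˡ 3) 7≤ ≡ p
          p≡ = toℕ-injective (trans (toℕ-inject≤ _ 7≤) (trans (toℕ-↑ˡ p̂ 3) (toℕ-fromℕ< p<4)))

          e≡ : link (toℕ p̂) (toℕ q̂) ≡ adj G a (at p)
          e≡ = trans (cong₂ link (toℕ-fromℕ< p<4) (toℕ-fromℕ< q<4)) (trans (linked-comm F (toℕ p) (toℕ q)) (sym link-a))

          X↪G : duplicate (member F 7) (p̂ ↑ˡ 3) (link (toℕ p̂) (toℕ q̂)) ↪ G
          X↪G = ↪-trans
            (subst₂ (λ r s → duplicate (member F 7) (p̂ ↑ˡ 3) (link (toℕ p̂) (toℕ q̂)) ↪ duplicate (member F (9 + m)) r s)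
              p≡ e≡ (duplicate-mono (member-mono F 7≤) (p̂ ↑ˡ 3) _))
            (duplicate-↪ G twins-p e p refl)

    attach : ∀ p q x → Dec (toℕ p < 4) → Dec (toℕ q < 4) → at p ≢ at q → at p ≢ at x → at q ≢ at x →
             Twins G a (at p) → Twins G a (at q) → adj G (at p) (at x) ≡ adj G (at p) (at q) →
             Outcome (members (suc (9 + m))) G
    attach p q x (no p≮4) _ p≢q _ _ twins twins′ _ = far twins twins′ (p≢q ∘ cong at) (≮⇒≥ p≮4)
    attach p q x (yes _) (no q≮4) p≢q _ _ twins twins′ _ = far twins′ twins (p≢q ∘ cong at ∘ sym) (≮⇒≥ q≮4)
    attach p q x (yes p<4) (yes q<4) p≢q p≢x q≢x twins twins′ common =
      near twins twins′ (p≢q ∘ cong at) p<4 q<4 (p≢x ∘ cong at ∘ sym) (q≢x ∘ cong at ∘ sym)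
        (trans (link-at (p≢x ∘ cong at)) (trans common (sym (link-at (p≢q ∘ cong at)))))

  attachTwin : ∀ {b b′ c} → a ≢ b → a ≢ b′ → a ≢ c → b ≢ b′ → b ≢ c → b′ ≢ c →
               Twins G a b → Twins G a b′ → adj G b c ≡ adj G b b′ →
               Outcome (members (suc (9 + m))) G
  attachTwin {b} {b′} {c} a≢b a≢b′ a≢c = from (position G e b a≢b) (position G e b′ a≢b′) (position G e c a≢c)
    where
    from : (∃ λ p → at p ≡ b) → (∃ λ q → at q ≡ b′) → (∃ λ x → at x ≡ c) → b ≢ b′ → b ≢ c → b′ ≢ c →
           Twins G a b → Twins G a b′ → adj G b c ≡ adj G b b′ → Outcome (members (suc (9 + m))) G
    from (p , refl) (q , refl) (x , refl) = attach p q x (toℕ p <? 4) (toℕ q <? 4)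

-- Among five homogeneous vertices of `G` minus vertex zero, three agree about vertex zero and are
-- pairwise twins in `G`. One is deleted, the other two serve as `b` and `b′`, and the fourth index
-- of the triple gives `c`. Homogeneous vertices are pairwise adjacent or pairwise nonadjacent,
-- which yields the last hypothesis of `attachTwin`.
tripleStep : ∀ m → (∀ G → Outcome (members (9 + m)) G) → ∀ G → Outcome (members (10 + m)) G
tripleStep m IH G = [ inj₁ ∘ certificate-↪ (delete-↪ G zero) , first ]′ (IH (delete G zero))
  where
  first : (∃ λ i → delete G zero ↪ members (9 + m) i) → Outcome (members (10 + m)) G
  first (f , e) = second (pigeonhole₅ (adj G zero ∘ v))
    where
    open Homogeneous (family f) {5 + m} G (↪-sym e)

    v : Fin 5 → Fin (10 + m)
    v q = vertex (q ↑ˡ m)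

    v-≢ : ∀ {q r} → q ≢ r → v q ≢ v r
    v-≢ q≢r = q≢r ∘ ↑ˡ-injective m _ _ ∘ vertex-injective

    second : Triple (adj G zero ∘ v) → Outcome (members (10 + m)) G
    second t = [ inj₁ ∘ certificate-↪ (delete-↪ G (v i₁)) , third ]′ (IH (delete G (v i₁)))
      where
      open Triple t

      third : (∃ λ h → delete G (v i₁) ↪ members (9 + m) h) → Outcome (members (10 + m)) G
      third (h , e′) = let ≢₁₂ , ≢₁₃ , ≢₁₄ , ≢₂₃ , ≢₂₄ , ≢₃₄ = distinct in
        attachTwin G (v i₁) h (↪-sym e′) (v-≢ ≢₁₂) (v-≢ ≢₁₃) (v-≢ ≢₁₄) (v-≢ ≢₂₃) (v-≢ ≢₂₄) (v-≢ ≢₃₄)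
          (vertex-twins _ _ (proj₁ constant)) (vertex-twins _ _ (proj₂ constant))
          (trans (vertex-adj (≢₂₄ ∘ ↑ˡ-injective m _ _)) (sym (vertex-adj (≢₂₃ ∘ ↑ˡ-injective m _ _))))

-- Distances in the members of a family

-- The type of a vertex: zero for the homogeneous part, suc j for the vertex at position j < 4.
Type : Set
Type = Fin 5

value : Type → ℕ
value zero    = 4
value (suc j) = toℕ j

module Typed (F : Family) where

  -- The entry at `zero`, `zero` concerns two distinct homogeneous vertices. A core type has a
  -- single vertex, hence no loop.
  typeAdj : Type → Type → Bool
  typeAdj zero    t       = linked F 4 (value t)
  typeAdj (suc i) zero    = linked F (toℕ i) 4
  typeAdj (suc i) (suc j) = not (does (i ≟ j)) ∧ linked F (toℕ i) (toℕ j)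

  Common : Type → Type → Set
  Common s t = ∃ λ q → typeAdj s q ≡ true × typeAdj q t ≡ true

  common? : ∀ s t → Dec (Common s t)
  common? s t = any? λ q → (typeAdj s q Bool.≟ true) ×-dec (typeAdj q t Bool.≟ true)

  private
    distance : Bool → {A : Set} → Dec A → ℕ
    distance true  _  = 1
    distance false A? = if does A? then 2 else 3

  opaque
    -- Meant for distinct vertices of the two types. The default 3 stands for everything beyond 2;
    -- `DiameterThree` makes it the true distance.
    typeDist : Type → Type → ℕ
    typeDist s t = distance (typeAdj s t) (common? s t)

    typeDist-bounds : ∀ s t → 1 ≤ typeDist s t × typeDist s t ≤ 3
    typeDist-bounds s t = bounds (typeAdj s t) (common? s t)
      where
      bounds : ∀ b {A} (A? : Dec A) → 1 ≤ distance b A? × distance b A? ≤ 3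
      bounds true  _       = s≤s z≤n , s≤s z≤n
      bounds false (yes _) = s≤s z≤n , s≤s (s≤s z≤n)
      bounds false (no _)  = s≤s z≤n , s≤s (s≤s (s≤s z≤n))

    typeDist-one : ∀ s t → typeAdj s t ≡ true → typeDist s t ≡ 1
    typeDist-one s t st = cong (λ b → distance b (common? s t)) st

    typeDist-one⁻ : ∀ s t → typeDist s t ≡ 1 → typeAdj s t ≡ true
    typeDist-one⁻ s t = one (typeAdj s t) (common? s t)
      where
      one : ∀ b {A} (A? : Dec A) → distance b A? ≡ 1 → b ≡ true
      one true  _       _  = refl
      one false (yes _) ()
      one false (no _)  ()

    typeDist-two : ∀ s t → Common s t → typeDist s t ≤ 2
    typeDist-two s t = two (typeAdj s t) (common? s t)
      where
      two : ∀ b {A} (A? : Dec A) → A → distance b A? ≤ 2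
      two true  _       _ = s≤s z≤n
      two false (yes _) _ = s≤s (s≤s z≤n)
      two false (no ¬a) a = contradiction a ¬a

    typeDist-two⁻ : ∀ s t → typeDist s t ≡ 2 → Common s t
    typeDist-two⁻ s t = two (typeAdj s t) (common? s t)
      where
      two : ∀ b {A} (A? : Dec A) → distance b A? ≡ 2 → A
      two false (yes a) _ = a

  DiameterThree : Set
  DiameterThree = ∀ s t → typeDist s t ≤ 2 ⊎ ∃ λ q → typeAdj q t ≡ true × typeDist s q ≤ 2

  diameterThree? : Dec DiameterThree
  diameterThree? = every? λ s → every? λ t →
    (typeDist s t ≤? 2) ⊎-dec (any? λ q → (typeAdj q t Bool.≟ true) ×-dec (typeDist s q ≤? 2))

  module Located {m} (G : Graph (7 + m)) (e : G ↪ member F (7 + m)) (diameter : DiameterThree) where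

    open _↪_ e using () renaming (to to pos; injective to pos-injective; preserves to pos-preserves)

    at : Fin (7 + m) → Fin (7 + m)
    at = Inverted.from e

    pos-at : ∀ p → pos (at p) ≡ p
    pos-at = Inverted.to-from e

    at-pos : ∀ u → at (pos u) ≡ u
    at-pos = Inverted.from-to e

    at-injective : ∀ {p q} → at p ≡ at q → p ≡ q
    at-injective {p} {q} eq = trans (sym (pos-at p)) (trans (cong pos eq) (pos-at q))

    typeAt : Fin (4 + (3 + m)) → Type
    typeAt p = [ suc , (λ _ → zero) ]′ (Fin.splitAt 4 p)

    type : Fin (7 + m) → Type
    type u = typeAt (pos u)

    core : Fin 4 → Fin (7 + m)
    core j = at (j ↑ˡ (3 + m))

    far : Fin (3 + m) → Fin (7 + m)
    far i = at (4 ↑ʳ i)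

    far-injective : ∀ {i j} → far i ≡ far j → i ≡ j
    far-injective = ↑ʳ-injective 4 _ _ ∘ at-injective

    data Place : Fin (7 + m) → Set where
      isCore : ∀ j → Place (core j)
      isFar  : ∀ i → Place (far i)

    locate : ∀ u → Place u
    locate u = subst Place (at-pos u) (go (pos u))
      where
      go : ∀ (p : Fin (4 + (3 + m))) → Place (at p)
      go p with Fin.splitAt 4 p in eq
      ... | inj₁ j = subst (Place ∘ at) (splitAt⁻¹-↑ˡ eq) (isCore j)
      ... | inj₂ i = subst (Place ∘ at) (splitAt⁻¹-↑ʳ eq) (isFar i)

    type-core : ∀ j → type (core j) ≡ suc j
    type-core j = trans (cong typeAt (pos-at _)) (cong [ suc , (λ _ → zero) ]′ (splitAt-↑ˡ 4 j (3 + m)))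

    type-far : ∀ i → type (far i) ≡ zero
    type-far i = trans (cong typeAt (pos-at _)) (cong [ suc , (λ _ → zero) ]′ (splitAt-↑ʳ 4 (3 + m) i))

    adj-at : ∀ {p q} → p ≢ q → adj G (at p) (at q) ≡ linked F (toℕ p) (toℕ q)
    adj-at {p} {q} p≢q = trans (pos-preserves _ _)
      (trans (cong₂ (adj (member F (7 + m))) (pos-at p) (pos-at q)) (adj-member F p≢q))

    adj-type : ∀ {u v} → u ≢ v → adj G u v ≡ typeAdj (type u) (type v)
    adj-type {u} {v} u≢v = go (locate u) (locate v) u≢v
      where
      far≥4 : ∀ i → 4 ≤ toℕ (4 ↑ʳ i)
      far≥4 i = subst (4 ≤_) (sym (toℕ-↑ʳ 4 i)) (m≤m+n 4 (toℕ {3 + m} i))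

      go : ∀ {u v} → Place u → Place v → u ≢ v → adj G u v ≡ typeAdj (type u) (type v)
      go (isCore i) (isCore j) u≢v rewrite type-core i | type-core j with i ≟ j
      ... | yes refl = contradiction refl u≢v
      ... | no i≢j   = trans (adj-at (u≢v ∘ cong at)) (cong₂ (linked F) (toℕ-↑ˡ i (3 + m)) (toℕ-↑ˡ j (3 + m)))
      go (isCore i) (isFar j) u≢v rewrite type-core i | type-far j =
        trans (adj-at (u≢v ∘ cong at)) (trans (linked-farʳ F _ _ (far≥4 j)) (cong (λ a → linked F a 4) (toℕ-↑ˡ i (3 + m))))
      go (isFar i) (isCore j) u≢v rewrite type-far i | type-core j =
        trans (adj-at (u≢v ∘ cong at)) (trans (linked-far F _ _ (far≥4 i)) (cong (linked F 4) (toℕ-↑ˡ j (3 + m))))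
      go (isFar i) (isFar j) u≢v rewrite type-far i | type-far j =
        trans (adj-at (u≢v ∘ cong at)) (trans (linked-far F _ _ (far≥4 i)) (linked-farʳ F 4 _ (far≥4 j)))

    -- A type adjacent to a core type is not that type itself, so a core witness avoids `u` and `v`
    -- automatically. For the homogeneous type there are at least three vertices, one of which
    -- differs from both.
    realise : ∀ q u v → ∃ λ w → type w ≡ q × (typeAdj (type u) q ≡ true → w ≢ u) × (typeAdj q (type v) ≡ true → w ≢ v)
    realise (suc j) u v = core j , type-core j
      , (λ adj≡ w≡u → loop (subst (λ t → typeAdj t (suc j) ≡ true) (trans (cong type (sym w≡u)) (type-core j)) adj≡))
      , (λ adj≡ w≡v → loop (subst (λ t → typeAdj (suc j) t ≡ true) (trans (cong type (sym w≡v)) (type-core j)) adj≡))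
      where
      loop : typeAdj (suc j) (suc j) ≢ true
      loop eq with j ≟ j
      loop () | yes _
      ... | no j≢j = j≢j refl
    realise zero u v = far (proj₁ free) , type-far _ , (λ _ → proj₁ (proj₂ free)) , (λ _ → proj₂ (proj₂ free))
      where
      third-free : ∀ {i} → suc (suc zero) ≢ i → far (suc (suc zero)) ≢ far i
      third-free ≢i = ≢i ∘ far-injective

      free : ∃ λ i → far i ≢ u × far i ≢ v
      free with far zero ≟ u | far zero ≟ v | far (suc zero) ≟ u | far (suc zero) ≟ v
      ... | no a     | no b     | _        | _        = zero , a , b
      ... | _        | _        | no a     | no b     = suc zero , a , b
      ... | yes refl | _        | yes b    | _        = contradiction (far-injective b) λ ()
      ... | _        | yes refl | _        | yes b    = contradiction (far-injective b) λ ()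
      ... | yes refl | _        | _        | yes refl = suc (suc zero) , third-free (λ ()) , third-free (λ ())
      ... | _        | yes refl | yes refl | _        = suc (suc zero) , third-free (λ ()) , third-free (λ ())

    private
      δ : Fin (7 + m) → Fin (7 + m) → ℕ
      δ u v = if does (u ≟ v) then 0 else typeDist (type u) (type v)

      δ-self : ∀ u → δ u u ≡ 0
      δ-self u with u ≟ u
      ... | yes _   = refl
      ... | no u≢u = contradiction refl u≢u

      δ-≢ : ∀ {u v} → u ≢ v → δ u v ≡ typeDist (type u) (type v)
      δ-≢ {u} {v} u≢v with u ≟ v
      ... | yes u≡v = contradiction u≡v u≢v
      ... | no _    = refl

      δ-≤typeDist : ∀ u v → δ u v ≤ typeDist (type u) (type v)
      δ-≤typeDist u v with u ≟ v
      ... | yes _ = z≤n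
      ... | no _  = ≤-refl

      δ-≤ : ∀ u v → δ u v ≤ 7 + m
      δ-≤ u v = ≤-trans (δ-≤typeDist u v) (≤-trans (proj₂ (typeDist-bounds _ _)) (m≤m+n 3 _))

      δ-zero : ∀ u v → δ u v ≡ 0 → u ≡ v
      δ-zero u v eq with u ≟ v
      ... | yes u≡v = u≡v
      ... | no _    = contradiction (subst (1 ≤_) eq (proj₁ (typeDist-bounds _ _))) λ ()

      adj⇒≢ : ∀ {u v} → adj G u v ≡ true → u ≢ v
      adj⇒≢ {u} uv refl = case trans (sym uv) (adj-irrefl G u) of λ ()

      adj⇒type : ∀ {u v} → adj G u v ≡ true → typeAdj (type u) (type v) ≡ true
      adj⇒type uv = trans (sym (adj-type (adj⇒≢ uv))) uv

      δ-step : ∀ u v w → adj G w v ≡ true → δ u v ≤ suc (δ u w)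
      δ-step u v w wv with u ≟ w
      ... | yes refl = ≤-trans (δ-≤typeDist u v) (≤-reflexive (typeDist-one _ _ (adj⇒type wv)))
      ... | no u≢w   = ≤-trans (δ-≤typeDist u v) bound
        where
        bound : typeDist (type u) (type v) ≤ suc (typeDist (type u) (type w))
        bound with m≤n⇒m<n∨m≡n (proj₁ (typeDist-bounds (type u) (type w)))
        ... | inj₁ 2≤d = ≤-trans (proj₂ (typeDist-bounds _ _)) (s≤s 2≤d)
        ... | inj₂ 1≡d = ≤-trans (typeDist-two _ _ (type w , typeDist-one⁻ _ _ (sym 1≡d) , adj⇒type wv))
                           (≤-reflexive (cong suc 1≡d))

      neighbour : ∀ q u v → typeAdj q (type v) ≡ true →
                  ∃ λ w → adj G w v ≡ true × type w ≡ q
      neighbour q u v qv with realise q u v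
      ... | w , refl , _ , w≢v = w , trans (adj-type (w≢v qv)) qv , refl

      δ-pred : ∀ u v k → δ u v ≡ suc k → ∃ λ w → adj G w v ≡ true × δ u w ≤ k
      δ-pred u v k eq with u ≟ v
      δ-pred u v 0 eq | no u≢v = u , trans (adj-type u≢v) (typeDist-one⁻ _ _ eq) , ≤-reflexive (δ-self u)
      δ-pred u v 1 eq | no u≢v with typeDist-two⁻ _ _ eq
      ... | q , uq , qv with realise q u v
      ...   | w , refl , w≢u , w≢v = w , trans (adj-type (w≢v qv)) qv ,
              ≤-trans (δ-≤typeDist u w) (≤-reflexive (typeDist-one _ _ uq))
      δ-pred u v (suc (suc k)) eq | no u≢v with diameter (type u) (type v)
      ... | inj₁ ≤2 = contradiction (subst (_≤ 2) eq ≤2) λ { (s≤s (s≤s ())) }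
      ... | inj₂ (q , qv , near) with neighbour q u v qv
      ...   | w , wv , refl = w , wv , ≤-trans (δ-≤typeDist u w) (≤-trans near (s≤s (s≤s z≤n)))

    dist-type : ∀ {u v} → u ≢ v → dist G u v ≡ typeDist (type u) (type v)
    dist-type {u} {v} u≢v =
      trans (dist-unique G δ δ-≤ δ-self δ-zero δ-step δ-pred u v) (δ-≢ u≢v)

-- Lower bounds

count : (Fin c → Bool) → ℕ
count {zero}  b = 0
count {suc c} b = if b zero then suc (count (b ∘ suc)) else count (b ∘ suc)

-- Read from the last position to the first, every class has a first element; b marks (at least) the other ones.
count-repeated : (f : Fin (c + m) → Fin k) (b : Fin c → Bool) →
                 (∀ i → b i ≡ false → ∀ y → i ↑ˡ m Fin.< y → f y ≢ f (i ↑ˡ m)) →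
                 (∀ {i j} → f (c ↑ʳ i) ≡ f (c ↑ʳ j) → i ≡ j) → c + m ≤ k + count b
count-repeated {zero}  {k = k}     f b _   inj = ≤-trans (injective⇒≤ inj) (≤-reflexive (sym (+-identityʳ k)))
count-repeated {suc c} {k = zero}  f b _   inj with () ← f zero
count-repeated {suc c} {m} {suc k} f b new inj with b zero in b0
... | true  = subst (suc (c + m) ≤_) (sym (+-suc (suc k) _))
                (s≤s (count-repeated (f ∘ suc) (b ∘ suc) (λ i bi y i<y → new (suc i) bi (suc y) (s≤s i<y)) inj))
... | false = s≤s (count-repeated f′ (b ∘ suc)
                (λ i bi y i<y eq → new (suc i) bi (suc y) (s≤s i<y) (punchOut-injective (≢0 _) (≢0 _) eq))
                (λ eq → inj (punchOut-injective (≢0 _) (≢0 _) eq)))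
  where
  ≢0 : ∀ y → f zero ≢ f (suc y)
  ≢0 y eq = new zero b0 (suc y) (s≤s z≤n) (sym eq)

  f′ : Fin (c + m) → Fin k
  f′ y = punchOut (≢0 y)

firstIn : (Fin c → Fin k) → Fin c → Fin c
firstIn f zero    = zero
firstIn f (suc i) = if does (f zero ≟ f (suc i)) then zero else suc (firstIn (f ∘ suc) i)

firstIn-class : (f : Fin c → Fin k) → ∀ i → f (firstIn f i) ≡ f i
firstIn-class f zero    = refl
firstIn-class f (suc i) with f zero ≟ f (suc i)
... | yes eq = eq
... | no _   = firstIn-class (f ∘ suc) i

firstIn-cong : (f : Fin c → Fin k) → ∀ i j → f i ≡ f j → firstIn f i ≡ firstIn f j
firstIn-cong f zero    zero    _  = refl
firstIn-cong f zero    (suc j) eq with f zero ≟ f (suc j)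
... | yes _ = refl
... | no ≢  = contradiction eq ≢
firstIn-cong f (suc i) zero    eq with f zero ≟ f (suc i)
... | yes _ = refl
... | no ≢  = contradiction (sym eq) ≢
firstIn-cong f (suc i) (suc j) eq with f zero ≟ f (suc i) | f zero ≟ f (suc j)
... | yes _ | yes _ = refl
... | yes e | no ≢  = contradiction (trans e eq) ≢
... | no ≢  | yes e = contradiction (trans e (sym eq)) ≢
... | no _  | no _  = cong suc (firstIn-cong (f ∘ suc) i j eq)

-- How a partition meets the core: r i is the first core vertex in the class of i,
-- and h i tells whether this class contains a vertex of the homogeneous part.
module Pattern (D : Vec (Vec ℕ 5) 5) (r : Vec (Fin 4) 4) (h : Vec Bool 4) where

  first : Fin 4 → Fin 4
  first = Vec.lookup r

  δ : Type → Type → ℕ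
  δ s t = Vec.lookup (Vec.lookup D s) t

  later? : ∀ i → Dec (∃ λ j → toℕ i < toℕ j × first j ≡ first i)
  later? i = any? λ j → (toℕ i <? toℕ j) ×-dec (first j ≟ first i)

  -- Homogeneous positions follow the core, so this is false exactly when `i` is the last position
  -- of its class.
  repeated : Fin 4 → Bool
  repeated i = Vec.lookup h i ∨ does (later? i)

  Meets : Fin 4 → Type → Set
  Meets i zero    = Vec.lookup h i ≡ true
  Meets i (suc j) = first j ≡ first i

  meets? : ∀ i s → Dec (Meets i s)
  meets? i zero    = Vec.lookup h i Bool.≟ true
  meets? i (suc j) = first j ≟ first i

  Closer : Type → Type → Fin 4 → Set
  Closer s t j = ∀ x → Meets j x → ∃ λ y → Meets j y × δ t y ≤ δ s x

  closer? : ∀ s t j → Dec (Closer s t j)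
  closer? s t j = every? λ x → meets? j x →-dec (any? λ y → meets? j y ×-dec (δ t y ≤? δ s x))

  -- `Closer` in both directions treats the other classes that meet the core. The equation
  -- `δ s zero ≡ δ t zero` treats the remaining classes, which consist of homogeneous vertices only.
  Unresolved : Set
  Unresolved = ∃ λ i → ∃ λ s → ∃ λ t → s ≢ t × Meets i s × Meets i t × δ s zero ≡ δ t zero ×
    (∀ j → first j ≢ first i → Closer s t j × Closer t s j)

  unresolved? : Dec Unresolved
  unresolved? = any? λ i → any? λ s → any? λ t → ¬? (s ≟ t) ×-dec meets? i s ×-dec meets? i t ×-dec
    (δ s zero ℕ.≟ δ t zero) ×-dec
    (every? λ j → ¬? (first j ≟ first i) →-dec (closer? s t j ×-dec closer? t s j))

  Coherent : Set
  Coherent = ∀ i → Vec.lookup h (first i) ≡ Vec.lookup h i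

  coherent? : Dec Coherent
  coherent? = every? λ i → Vec.lookup h (first i) Bool.≟ Vec.lookup h i

Idempotent : Vec (Fin 4) 4 → Set
Idempotent r = ∀ i → Vec.lookup r (Vec.lookup r i) ≡ Vec.lookup r i

idempotent? : ∀ r → Dec (Idempotent r)
idempotent? r = every? λ i → Vec.lookup r (Vec.lookup r i) ≟ Vec.lookup r i

allTuples : ∀ c → (Vec (Fin k) c → Bool) → Bool
allTuples zero    p = p []
allTuples (suc c) p = allVertices λ i → allTuples c (p ∘ (i ∷_))

allTuples-sound : ∀ c (p : Vec (Fin k) c → Bool) → allTuples c p ≡ true → ∀ v → p v ≡ true
allTuples-sound zero    p ok []      = ok
allTuples-sound (suc c) p ok (i ∷ v) =
  allTuples-sound c (p ∘ (i ∷_)) (allVertices-sound (λ i → allTuples c (p ∘ (i ∷_))) ok i) v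

distances : Family → Vec (Vec ℕ 5) 5
distances F = Vec.tabulate λ s → Vec.tabulate (Typed.typeDist F s)

does⇒ : {A : Set} (A? : Dec A) → does A? ≡ true → A
does⇒ (yes a) _ = a

module _ (d : ℕ) (D : Vec (Vec ℕ 5) 5) where

  open Pattern D

  private
    unresolvedWith : Vec (Fin 4) 4 → Vec Bool 4 → Bool
    unresolvedWith r h = does (coherent? r h →-dec ((d ≤? count (repeated r h)) →-dec unresolved? r h))

    unresolvedAt : Vec (Fin 4) 4 → Bool
    unresolvedAt r = not (does (idempotent? r)) ∨ allRows 4 (unresolvedWith r)

  unresolvedCheck : Bool
  unresolvedCheck = allTuples 4 unresolvedAt

  unresolvedCheck-sound : unresolvedCheck ≡ true → ∀ r h → Idempotent r → Coherent r h →
                          d ≤ count (repeated r h) → Unresolved r h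
  unresolvedCheck-sound ok r h idem = does⇒ (coherent? r h →-dec ((d ≤? count (repeated r h)) →-dec unresolved? r h))
    (allRows-sound 4 (unresolvedWith r) (strip (idempotent? r) (allTuples-sound 4 unresolvedAt ok r)) h)
    where
    strip : {b : Bool} (I? : Dec (Idempotent r)) → not (does I?) ∨ b ≡ true → b ≡ true
    strip (yes _) eq = eq
    strip (no ¬i) _  = contradiction idem ¬i

module LowerBound (F : Family) (diameter : Typed.DiameterThree F) {m} (G : Graph (7 + m)) (e : G ↪ member F (7 + m))
                  (P : ResolvingPartition G k) where

  open Typed F using (typeDist)
  open Typed.Located F G e diameter
  open ResolvingPartition P

  private
    D : Vec (Vec ℕ 5) 5
    D = distances F

    D-dist : ∀ s t → Vec.lookup (Vec.lookup D s) t ≡ typeDist s t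
    D-dist s t = trans (cong (λ row → Vec.lookup row t) (lookup∘tabulate (λ s → Vec.tabulate (typeDist s)) s))
                       (lookup∘tabulate (typeDist s) t)

    dist-apart : ∀ {u v} → cls u ≢ cls v → dist G u v ≡ typeDist (type u) (type v)
    dist-apart u≁v = dist-type (u≁v ∘ cong cls)

    -- Homogeneous vertices have the same type and hence equal distances to everything outside a
    -- common class, so `indistinguishable` applies.
    twins-apart : ∀ {i j} → cls (far i) ≡ cls (far j) → i ≡ j
    twins-apart {i} {j} same with i ≟ j
    ... | yes i≡j = i≡j
    ... | no  i≢j = ⊥-elim (indistinguishable G P (i≢j ∘ far-injective) same
        (λ w w≁i → w , refl , ≤-reflexive (equal w same w≁i))
        (λ w w≁i → w , refl , ≤-reflexive (sym (equal w same w≁i))))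
      where
      equal : ∀ w → cls (far i) ≡ cls (far j) → cls w ≢ cls (far i) → dist G (far j) w ≡ dist G (far i) w
      equal w same w≁i = trans (dist-apart (λ eq → w≁i (trans (sym eq) (sym same))))
        (trans (cong (λ s → typeDist s (type w)) (trans (type-far j) (sym (type-far i))))
          (sym (dist-apart (w≁i ∘ sym))))

    module Configuration (r : Vec (Fin 4) 4) (h : Vec Bool 4)
      (first⇒cls : ∀ {i j} → Vec.lookup r i ≡ Vec.lookup r j → cls (core i) ≡ cls (core j))
      (cls⇒first : ∀ {i j} → cls (core i) ≡ cls (core j) → Vec.lookup r i ≡ Vec.lookup r j)
      (far⇒h     : ∀ {i} j → cls (far j) ≡ cls (core i) → Vec.lookup h i ≡ true)
      (h⇒far     : ∀ {i} → Vec.lookup h i ≡ true → ∃ λ j → cls (far j) ≡ cls (core i)) where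

      open Pattern D r h

      meets⇒vertex : ∀ {i s} → Meets i s → ∃ λ w → type w ≡ s × cls w ≡ cls (core i)
      meets⇒vertex {i} {zero}  hi = let j , eq = h⇒far hi in far j , type-far j , eq
      meets⇒vertex {i} {suc j} eq = core j , type-core j , first⇒cls eq

      vertex⇒meets : ∀ {i} w → cls w ≡ cls (core i) → Meets i (type w)
      vertex⇒meets {i} w w∈i = go (locate w) w∈i
        where
        go : ∀ {w} → Place w → cls w ≡ cls (core i) → Meets i (type w)
        go (isCore j) eq = subst (Meets i) (sym (type-core j)) (cls⇒first eq)
        go (isFar j)  eq = subst (Meets i) (sym (type-far j)) (far⇒h j eq)

      -- If the class of `w` meets the core, the pattern knows its types and `Closer` supplies `w′`.
      -- Otherwise `w` is homogeneous and can be kept.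
      near : ∀ {i u v} w → cls w ≢ cls (core i) → cls u ≡ cls (core i) → cls v ≡ cls (core i) →
             δ (type u) zero ≡ δ (type v) zero →
             (∀ j → first j ≢ first i → Closer (type u) (type v) j) →
             ∃ λ w′ → cls w′ ≡ cls w × dist G v w′ ≤ dist G u w
      near {i} {u} {v} w w∉i u∈i v∈i equal-far elsewhere = decide (any? (λ j → cls w ≟ cls (core j)))
        where
        decide : Dec (∃ λ j → cls w ≡ cls (core j)) → ∃ λ w′ → cls w′ ≡ cls w × dist G v w′ ≤ dist G u w
        decide (yes (j , w∈j)) = closest (elsewhere j (λ eq → w∉i (trans w∈j (first⇒cls eq))) (type w) (vertex⇒meets w w∈j))
          where
          closest : (∃ λ y → Meets j y × δ (type v) y ≤ δ (type u) (type w)) →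
                    ∃ λ w′ → cls w′ ≡ cls w × dist G v w′ ≤ dist G u w
          closest (y , j∋y , le) = measure (meets⇒vertex {j} {y} j∋y)
            where
            measure : (∃ λ w′ → type w′ ≡ y × cls w′ ≡ cls (core j)) →
                      ∃ λ w′ → cls w′ ≡ cls w × dist G v w′ ≤ dist G u w
            measure (w′ , refl , w′∈j) = w′ , trans w′∈j (sym w∈j) ,
              subst₂ _≤_ (sym (trans (dist-apart (λ eq → w∉i (trans w∈j (trans (sym w′∈j) (trans (sym eq) v∈i)))))
                                (sym (D-dist _ _))))
                         (sym (trans (dist-apart (λ eq → w∉i (trans (sym eq) u∈i))) (sym (D-dist _ _)))) le
        decide (no w∉core) = w , refl , ≤-reflexive (trans (apart v∈i) (trans (sym equal-far) (sym (apart u∈i))))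
          where
          w-far : ∀ {w} → Place w → (∀ j → cls w ≢ cls (core j)) → type w ≡ zero
          w-far (isCore j) ∉core = contradiction refl (∉core j)
          w-far (isFar j)  _     = type-far j

          apart : ∀ {x} → cls x ≡ cls (core i) → dist G x w ≡ δ (type x) zero
          apart x∈i = trans (dist-apart (λ eq → w∉i (trans (sym eq) x∈i)))
            (trans (cong (typeDist _) (w-far (locate w) (λ j eq → w∉core (j , eq)))) (sym (D-dist _ zero)))

      contradictory : ¬ Unresolved
      contradictory (i , s , t , s≢t , i∋s , i∋t , equal-far , elsewhere) =
        places (meets⇒vertex {i} {s} i∋s) (meets⇒vertex {i} {t} i∋t)
        where
        places : (∃ λ u → type u ≡ s × cls u ≡ cls (core i)) → (∃ λ v → type v ≡ t × cls v ≡ cls (core i)) → ⊥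
        places (u , refl , u∈i) (v , refl , v∈i) = indistinguishable G P (s≢t ∘ cong type) (trans u∈i (sym v∈i))
          (λ w w≁u → near w (λ eq → w≁u (trans eq (sym u∈i))) u∈i v∈i equal-far (λ j j≁i → proj₁ (elsewhere j j≁i)))
          (λ w w≁u → near w (λ eq → w≁u (trans eq (sym u∈i))) v∈i u∈i (sym equal-far) (λ j j≁i → proj₂ (elsewhere j j≁i)))

      not-repeated : ∀ i → repeated i ≡ false → ∀ y → i ↑ˡ (3 + m) Fin.< y → cls (at y) ≢ cls (core i)
      not-repeated i ¬rep y i<y same with Fin.splitAt 4 {3 + m} y in eq
      ... | inj₂ j = not-¬ ¬rep (cong (_∨ _) (far⇒h j (trans (cong (cls ∘ at) (splitAt⁻¹-↑ʳ eq)) same)))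
      ... | inj₁ j = not-¬ ¬rep (trans (cong (Vec.lookup h i ∨_) later) (Bool.∨-zeroʳ _))
        where
        y≡ : j ↑ˡ (3 + m) ≡ y
        y≡ = splitAt⁻¹-↑ˡ eq

        later : does (later? i) ≡ true
        later = dec-true (later? i) (j , subst₂ _<_ (toℕ-↑ˡ i (3 + m)) (trans (cong toℕ (sym y≡)) (toℕ-↑ˡ j (3 + m))) i<y
                  , cls⇒first (trans (cong (cls ∘ at) y≡) same))

    firsts : Vec (Fin 4) 4
    firsts = Vec.tabulate (firstIn (cls ∘ core))

    hasFar? : ∀ i → Dec (∃ λ j → cls (far j) ≡ cls (core i))
    hasFar? i = any? λ j → cls (far j) ≟ cls (core i)

    mixed : Vec Bool 4
    mixed = Vec.tabulate (does ∘ hasFar?)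

    first≡ : ∀ i → Vec.lookup firsts i ≡ firstIn (cls ∘ core) i
    first≡ = lookup∘tabulate (firstIn (cls ∘ core))

    first⇒cls : ∀ {i j} → Vec.lookup firsts i ≡ Vec.lookup firsts j → cls (core i) ≡ cls (core j)
    first⇒cls {i} {j} eq = trans (sym (firstIn-class (cls ∘ core) i))
      (trans (cong (cls ∘ core) (trans (sym (first≡ i)) (trans eq (first≡ j)))) (firstIn-class (cls ∘ core) j))

    cls⇒first : ∀ {i j} → cls (core i) ≡ cls (core j) → Vec.lookup firsts i ≡ Vec.lookup firsts j
    cls⇒first {i} {j} eq = trans (first≡ i) (trans (firstIn-cong (cls ∘ core) i j eq) (sym (first≡ j)))

    cls-first : ∀ i → cls (core (Vec.lookup firsts i)) ≡ cls (core i)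
    cls-first i = trans (cong (cls ∘ core) (first≡ i)) (firstIn-class (cls ∘ core) i)

    mixed≡ : ∀ i → Vec.lookup mixed i ≡ does (hasFar? i)
    mixed≡ = lookup∘tabulate (does ∘ hasFar?)

    far⇒mixed : ∀ {i} j → cls (far j) ≡ cls (core i) → Vec.lookup mixed i ≡ true
    far⇒mixed {i} j eq = trans (mixed≡ i) (dec-true (hasFar? i) (j , eq))

    mixed⇒far : ∀ {i} → Vec.lookup mixed i ≡ true → ∃ λ j → cls (far j) ≡ cls (core i)
    mixed⇒far {i} eq = does⇒ (hasFar? i) (trans (sym (mixed≡ i)) eq)

    idempotent : Idempotent firsts
    idempotent i = cls⇒first (cls-first i)

    mixed-resp : ∀ {i j} → cls (core i) ≡ cls (core j) → Vec.lookup mixed i ≡ true → Vec.lookup mixed j ≡ true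
    mixed-resp eq hi = let x , x∈ = mixed⇒far hi in far⇒mixed x (trans x∈ eq)

    coherent : Pattern.Coherent D firsts mixed
    coherent i = Bool.⇔→≡ {z = true} (mk⇔ (mixed-resp (cls-first i)) (mixed-resp (sym (cls-first i))))

    module C = Configuration firsts mixed first⇒cls cls⇒first far⇒mixed mixed⇒far

  -- By `count-repeated`, `7 + m` is at most `k` plus the number of repeated core positions. If
  -- `k + d ≤ 7 + m`, at least `d` positions are repeated, and the check then finds an unresolved
  -- pair.
  lowerBound : ∀ d → unresolvedCheck d (distances F) ≡ true → ¬ k + d ≤ 7 + m
  lowerBound d ok k+d≤n = C.contradictory
    (unresolvedCheck-sound d (distances F) ok firsts mixed idempotent coherent
      (+-cancelˡ-≤ k _ _ (≤-trans k+d≤n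
        (count-repeated {4} {3 + m} (cls ∘ at) (Pattern.repeated D firsts mixed) C.not-repeated twins-apart))))

-- Classification

ExtensionsListed : ∀ {k k′} → (Fin k → Graph n) → (Fin k′ → Graph (suc n)) → Set
ExtensionsListed graph graph′ = extensionCheck graph graph′ (targets graph graph′) ≡ true

opaque
  unfolding recognised

  extensions₀ : ExtensionsListed (graphs 0) (graphs 1)
  extensions₀ = refl

  extensions₁ : ExtensionsListed (graphs 1) (graphs 2)
  extensions₁ = refl

  extensions₂ : ExtensionsListed (graphs 2) (graphs 3)
  extensions₂ = refl

  extensions₃ : ExtensionsListed (graphs 3) (graphs 4)
  extensions₃ = refl

  extensions₄ : ExtensionsListed (graphs 4) (graphs 5)
  extensions₄ = refl

  extensions₅ : ExtensionsListed (graphs 5) (graphs 6)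
  extensions₅ = refl

  extensions₆ : ExtensionsListed (graphs 6) (members 7)
  extensions₆ = refl

  duplicates₇ : DuplicatesListed 0
  duplicates₇ = refl

  duplicates₈ : DuplicatesListed 1
  duplicates₈ = refl

opaque
  unfolding Typed.typeDist

  listed-unresolved : allVertices (λ i → unresolvedCheck 3 (distances (Vec.lookup partitionDimension-n-2 i))) ≡ true
  listed-unresolved = refl

  larger-unresolved : allVertices (λ i → unresolvedCheck 2 (distances (Vec.lookup larger i))) ≡ true
  larger-unresolved = refl

  listed-diameter : allVertices (λ i → does (Typed.diameterThree? (Vec.lookup partitionDimension-n-2 i))) ≡ true
  listed-diameter = refl

  larger-diameter : allVertices (λ i → does (Typed.diameterThree? (Vec.lookup larger i))) ≡ true
  larger-diameter = refl

classification₆ : (G : Graph 6) → Outcome (graphs 6) G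
classification₆ =
  extensionStep (graphs 5) (graphs 6) extensions₅
  (extensionStep (graphs 4) (graphs 5) extensions₄
  (extensionStep (graphs 3) (graphs 4) extensions₃
  (extensionStep (graphs 2) (graphs 3) extensions₂
  (extensionStep (graphs 1) (graphs 2) extensions₁
  (extensionStep (graphs 0) (graphs 1) extensions₀
    -- The default clause of `codes` lists the code 0, here of the graph without vertices.
    λ G → inj₂ (zero , record { to = λ () ; injective = λ { {()} } ; preserves = λ () }))))))

classification : ∀ m (G : Graph (7 + m)) → Outcome (members (7 + m)) G
classification 0 = extensionStep (graphs 6) (members 7) extensions₆ classification₆
classification 1 = duplicateStep 0 duplicates₇ (classification 0)
classification 2 = duplicateStep 1 duplicates₈ (classification 1)
classification (suc (suc (suc m))) = tripleStep m (classification (suc (suc m)))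

-- Disconnected families, exact partition dimension and the equivalence

Splits : Family → Fin 2 → Set
Splits F d = ∀ (a : Fin 2) (b : Fin 5) → toℕ a ≤ toℕ d → toℕ d < toℕ b → linked F (toℕ a) (toℕ b) ≡ false

splits? : ∀ F d → Dec (Splits F d)
splits? F d = every? λ a → every? λ b →
  (toℕ a ≤? toℕ d) →-dec ((toℕ d <? toℕ b) →-dec (linked F (toℕ a) (toℕ b) Bool.≟ false))

-- No edge leaves the positions up to `d`, so every ball around position 0 stays there, whereas
-- position 4 lies outside because `d` is at most 1.
splits⇒disconnected : ∀ F d → Splits F d → {G : Graph (7 + m)} → G ↪ member F (7 + m) → ¬ Connected G
splits⇒disconnected {m} F d splits {G} e connected =
  n≮n 1 (≤-trans (≤-trans (s≤s (s≤s z≤n)) (≤-reflexive (cong toℕ (sym (to-from 4F)))))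
    (≤-trans (stays steps (from 4F) reached) (s≤s⁻¹ (toℕ<n d))))
  where
  open _↪_ e
  open Inverted e

  steps   = proj₁ (connected (from 0F) (from 4F))
  reached = proj₂ (connected (from 0F) (from 4F))

  apart : ∀ x y → x ≤ toℕ d → toℕ d < y → linked F x y ≡ false
  apart x y x≤d d<y = trans (linked-⊓ F x y)
    (subst₂ (λ a b → linked F a b ≡ false) (toℕ-fromℕ< x<2) (toℕ-fromℕ< y<5)
      (splits (fromℕ< x<2) (fromℕ< y<5)
        (subst (_≤ toℕ d) (sym (toℕ-fromℕ< x<2)) x≤d)
        (subst (toℕ d <_) (sym (toℕ-fromℕ< y<5)) (⊓-glb d<y (≤-trans (toℕ<n d) (m≤m+n 2 2))))))
    where
    x<2 = ≤-trans (s≤s x≤d) (toℕ<n d)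
    y<5 = s≤s (m⊓n≤n y 4)

  stays : ∀ k w → ball G k (from 0F) w ≡ true → toℕ (to w) ≤ toℕ d
  stays zero w near = subst (λ p → toℕ p ≤ toℕ d) (trans (sym (to-from 0F)) (cong to (⌊⌋⁻ (from 0F ≟ w) near))) z≤n
  stays (suc k) w near with ball-suc⁻ G k (from 0F) w near
  ... | inj₁ near′ = stays k w near′
  ... | inj₂ (x , near′ , xw) with toℕ (to w) ≤? toℕ d
  ...   | yes w≤d = w≤d
  ...   | no  w≰d = contradiction (trans (sym (preserves x w)) xw)
            (not-¬ (trans (adj-member F x≢w) (apart _ _ (stays k x near′) (≰⇒> w≰d))))
    where
    x≢w : to x ≢ to w
    x≢w eq = w≰d (subst (λ p → toℕ p ≤ toℕ d) eq (stays k x near′))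

disconnected-splits : ∀ i → ∃ (Splits (Vec.lookup disconnected i))
disconnected-splits i = does⇒ (any? (splits? (Vec.lookup disconnected i)))
  (allVertices-sound (λ i → does (any? (splits? (Vec.lookup disconnected i)))) refl i)

merges₂ : List (Vec ℕ 2)
merges₂ = (40 ∷ 51 ∷ []) ∷ (10 ∷ 20 ∷ []) ∷ []

-- Two absorbed vertices leave at most `n - 2` classes. Order 7 suffices, since larger members
-- contain the member of order 7 as an induced subgraph.
listed-certificate : ∀ i → Certificate (member (Vec.lookup partitionDimension-n-2 i) 7) 2
listed-certificate i = fromJust (search i) (allVertices-sound (is-just ∘ search) refl i)
  where
  search : ∀ i → Maybe (Certificate (member (Vec.lookup partitionDimension-n-2 i) 7) 2)
  search i = firstJust (certificate? (member (Vec.lookup partitionDimension-n-2 i) 7)) merges₂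

lowerBoundAt : ∀ {c} (Fs : Vec Family c) d →
               allVertices (λ i → unresolvedCheck d (distances (Vec.lookup Fs i))) ≡ true →
               allVertices (λ i → does (Typed.diameterThree? (Vec.lookup Fs i))) ≡ true →
               ∀ i {G : Graph (7 + m)} → G ↪ member (Vec.lookup Fs i) (7 + m) →
               ResolvingPartition G k → ¬ k + d ≤ 7 + m
lowerBoundAt Fs d unresolved diameter i {G} e P = LowerBound.lowerBound (Vec.lookup Fs i)
  (does⇒ (Typed.diameterThree? (Vec.lookup Fs i))
    (allVertices-sound (λ i → does (Typed.diameterThree? (Vec.lookup Fs i))) diameter i))
  G e P d (allVertices-sound (λ i → unresolvedCheck d (distances (Vec.lookup Fs i))) unresolved i)

lookup-++⁻ : {A : Set} (P : A → Set) (xs : Vec A m) {ys : Vec A n} (i : Fin (m + n)) → P (Vec.lookup (xs ++ ys) i) →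
             (∃ λ j → P (Vec.lookup xs j)) ⊎ (∃ λ j → P (Vec.lookup ys j))
lookup-++⁻ P []       i       p = inj₂ (i , p)
lookup-++⁻ P (x ∷ xs) zero    p = inj₁ (zero , p)
lookup-++⁻ P (x ∷ xs) (suc i) p = Sum.map₁ (λ (j , q) → suc j , q) (lookup-++⁻ P xs i p)

module _ {m} (G : Graph (7 + m)) where

  Listed : Set
  Listed = ∃ λ i → G ↪ member (Vec.lookup partitionDimension-n-2 i) (7 + m)

  listed⇒dimension : Listed → PartitionDimension G (5 + m)
  listed⇒dimension (i , e) = exact (certificate⇒resolvingPartition (s≤s (s≤s z≤n))
      (certificate-↪ (↪-trans (member-mono (Vec.lookup partitionDimension-n-2 i) (m≤m+n 7 m)) (↪-sym e))
        (listed-certificate i)))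
    , λ k P → minimal k P
    where
    minimal : ∀ k → ResolvingPartition G k → 5 + m ≤ k
    minimal k P = ≮⇒≥ λ k<5+m → lowerBoundAt partitionDimension-n-2 3 listed-unresolved listed-diameter i e P
      (≤-trans (≤-reflexive (+-comm k 3)) (s≤s (s≤s k<5+m)))

    -- The certificate bounds the number of classes only from above; the lower bound forces
    -- equality.
    exact : (∃ λ k → k + 2 ≤ 7 + m × ResolvingPartition G k) → ResolvingPartition G (5 + m)
    exact (k , k+2≤n , P) = subst (ResolvingPartition G)
      (≤-antisym (s≤s⁻¹ (s≤s⁻¹ (≤-trans (≤-reflexive (+-comm 2 k)) k+2≤n))) (minimal k P)) P

  dimension⇒listed : Connected G → PartitionDimension G (5 + m) → Listed
  dimension⇒listed connected (P , minimal) = [ ⊥-elim ∘ tooFine , sort ]′ (classification m G)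
    where
    tooFine : ¬ Certificate G 3
    tooFine C = let k , k+3≤n , P′ = certificate⇒resolvingPartition (s≤s (s≤s z≤n)) C in
      n≮n (7 + m) (≤-trans (≤-reflexive (+-comm 3 (5 + m))) (≤-trans (+-monoˡ-≤ 3 (minimal k P′)) k+3≤n))

    sort : (∃ λ i → G ↪ members (7 + m) i) → Listed
    sort (i , e) with lookup-++⁻ (λ F → G ↪ member F (7 + m)) partitionDimension-n-2 i e
    ... | inj₁ listed = listed
    ... | inj₂ (j , f) with lookup-++⁻ (λ F → G ↪ member F (7 + m)) larger j f
    ...   | inj₁ (l , g) = contradiction (≤-reflexive (+-comm (5 + m) 2))
              (lowerBoundAt larger 2 larger-unresolved larger-diameter l g P)
    ...   | inj₂ (l , g) = contradiction connected
              (splits⇒disconnected (Vec.lookup disconnected l) _ (proj₂ (disconnected-splits l)) g)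

-- Without an empty alternative at the end, this unfolds on `partitionDimension-n-2` to the sum in
-- the theorem: each listed `member` is definitionally the corresponding graph `H1 n`, `H2 n`, and
-- so on.
OneOf : {A : Set} → Vec A (suc k) → (A → Set) → Set
OneOf (x ∷ [])     P = P x
OneOf (x ∷ y ∷ xs) P = P x ⊎ OneOf (y ∷ xs) P

oneOf⁺ : {A : Set} {P : A → Set} (xs : Vec A (suc k)) → (∃ λ i → P (Vec.lookup xs i)) → OneOf xs P
oneOf⁺ (x ∷ [])     (zero , p)  = p
oneOf⁺ (x ∷ y ∷ xs) (zero , p)  = inj₁ p
oneOf⁺ (x ∷ y ∷ xs) (suc i , p) = inj₂ (oneOf⁺ (y ∷ xs) (i , p))

oneOf⁻ : {A : Set} {P : A → Set} (xs : Vec A (suc k)) → OneOf xs P → ∃ λ i → P (Vec.lookup xs i)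
oneOf⁻ (x ∷ [])     p        = zero , p
oneOf⁻ (x ∷ y ∷ xs) (inj₁ p) = zero , p
oneOf⁻ (x ∷ y ∷ xs) (inj₂ p) = let i , pi = oneOf⁻ (y ∷ xs) p in suc i , pi

mainTheorem4 : (n : ℕ) → (G : Graph n) → 7 ≤ n → Connected G →
    (PartitionDimension G (n ∸ 2) ⇔
    (G ≅ H1 n ⊎ G ≅ H2 n ⊎ G ≅ H3 n ⊎ G ≅ H4 n ⊎ G ≅ H5 n ⊎ G ≅ H6 n ⊎ G ≅ H7 n
    ⊎ G ≅ H8 n ⊎ G ≅ H9 n ⊎ G ≅ H10 n ⊎ G ≅ H11 n ⊎ G ≅ H13 n ⊎ G ≅ H14 n
    ⊎ G ≅ H15 n ⊎ G ≅ H16 n))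
mainTheorem4 _ G (s≤s (s≤s (s≤s (s≤s (s≤s (s≤s (s≤s {n = m} z≤n))))))) connected = mk⇔
  (λ dimension → let i , e = dimension⇒listed G connected dimension in
    oneOf⁺ {P = λ F → G ≅ member F (7 + m)} partitionDimension-n-2 (i , ↪⇒≅ (↪-sym e)))
  (λ among → let i , φ = oneOf⁻ {P = λ F → G ≅ member F (7 + m)} partitionDimension-n-2 among in
    listed⇒dimension G (i , ≅⇒↪ φ))
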